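{- For every $d\ge 1$, the following three sets are pairwise in bijection (equivalently, have the same cardinality): (i) the set of binary de Bruijn words of order $d+1$; (ii) the set of binary necklaces of length $2^d$ having an odd number of $1$'s; (iii) the set of unordered normal bases of $\mathrm{GF}_{2^{2^d}}$ over $\mathrm{GF}_2$.
   Context: A necklace is the set of rotations (conjugacy class) of a word. A binary de Bruijn word of order $m$ is a necklace of length $2^m$ over $\{0,1\}$ in which each of the $2^m$ binary words of length $m$ occurs exactly once as a cyclic factor. A normal basis of $\mathrm{GF}_{2^N}$ is a basis over $\mathrm{GF}_2$ of the form $\{\gamma,\gamma^2,\gamma^4,\ldots,\gamma^{2^{N-1}}\}$. -}

module Defs where

open import Level using (Level; _⊔_) renaming (suc to lsuc)
open import Data.Bool using (Bool; true; false; if_then_else_)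
open import Data.Nat using (ℕ; zero; suc; _^_; _%_) renaming (_+_ to _+ℕ_)
open import Data.Nat.DivMod using (_mod_)
open import Data.Fin using (Fin; toℕ) renaming (zero to fzero; suc to fsuc)
open import Data.Product using (Σ; _×_; _,_)
open import Relation.Nullary using (¬_)
open import Relation.Binary.PropositionalEquality using (_≡_)
import Relation.Binary.PropositionalEquality as ≡
open import Algebra.Bundles using (CommutativeRing)
open import Function.Bundles using (Bijection)

Word : ℕ → Set
Word n = Fin n → Bool

_⊕_ : {n : ℕ} → Fin n → ℕ → Fin n
_⊕_ {suc n} i k = (toℕ i +ℕ k) mod (suc n)

_∼ₙ_ : {n : ℕ} → Word n → Word n → Set
_∼ₙ_ {n} w w′ = Σ ℕ λ k → ∀ (i : Fin n) → w′ i ≡ w (i ⊕ k)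

cycFactor : {n : ℕ} → Word n → Fin n → (m : ℕ) → Word m
cycFactor w i m j = w (i ⊕ toℕ j)

_≗w_ : {m : ℕ} → Word m → Word m → Set
_≗w_ {m} u v = ∀ (j : Fin m) → u j ≡ v j

IsDeBruijn : (m : ℕ) → Word (2 ^ m) → Set
IsDeBruijn m w = ∀ (u : Word m) →
  Σ (Fin (2 ^ m)) λ i → (cycFactor w i m ≗w u)
    × (∀ (j : Fin (2 ^ m)) → cycFactor w j m ≗w u → j ≡ i)

ones : {n : ℕ} → Word n → ℕ
ones {zero}  w = 0
ones {suc n} w = (if w fzero then 1 else 0) +ℕ ones (λ i → w (fsuc i))

-- "The sets A/~ and B/≈ are in bijection", for types A, B carrying
-- equivalence relations: a map A → B that respects the relations and
-- induces a bijection of the quotients.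

record QuotBij {a b r s : Level} (A : Set a) (_~_ : A → A → Set r)
               (B : Set b) (_≈_ : B → B → Set s) : Set (a ⊔ b ⊔ r ⊔ s) where
  field
    to         : A → B
    to-cong    : ∀ {x y} → x ~ y → to x ≈ to y
    to-inj     : ∀ {x y} → to x ≈ to y → x ~ y
    to-surj    : ∀ (z : B) → Σ A λ x → to x ≈ z

-- (i) de Bruijn words of order m (as necklaces)
DeBruijn : ℕ → Set
DeBruijn m = Σ (Word (2 ^ m)) (IsDeBruijn m)

_∼DB_ : {m : ℕ} → DeBruijn m → DeBruijn m → Set
(w , _) ∼DB (w′ , _) = w ∼ₙ w′

OddWord : ℕ → Set
OddWord n = Σ (Word n) λ w → ones w % 2 ≡ 1

_∼Odd_ : {n : ℕ} → OddWord n → OddWord n → Set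
(w , _) ∼Odd (w′ , _) = w ∼ₙ w′

record Field (c ℓ : Level) : Set (lsuc (c ⊔ ℓ)) where
  field
    commutativeRing : CommutativeRing c ℓ
  open CommutativeRing commutativeRing public
  field
    0≉1     : ¬ (0# ≈ 1#)
    inverse : ∀ (x : Carrier) → ¬ (x ≈ 0#) → Σ Carrier λ y → x * y ≈ 1#

HasOrder : {c ℓ : Level} → Field c ℓ → ℕ → Set (c ⊔ ℓ)
HasOrder F q = Bijection (≡.setoid (Fin q)) (Field.setoid F)

module _ {c ℓ : Level} (F : Field c ℓ) where
  open Field F

  pow : Carrier → ℕ → Carrier
  pow x zero    = 1#
  pow x (suc n) = x * pow x n

  lincomb : {N : ℕ} → (Fin N → Bool) → (Fin N → Carrier) → Carrier
  lincomb {zero}  c v = 0#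
  lincomb {suc N} c v =
    (if c fzero then v fzero else 0#) + lincomb (λ i → c (fsuc i)) (λ i → v (fsuc i))

  IsGF2Basis : {N : ℕ} → (Fin N → Carrier) → Set (c ⊔ ℓ)
  IsGF2Basis {N} v =
    (∀ (cs : Fin N → Bool) → lincomb cs v ≈ 0# → ∀ (i : Fin N) → cs i ≡ false)
    × (∀ (x : Carrier) → Σ (Fin N → Bool) λ cs → lincomb cs v ≈ x)

  conj : (N : ℕ) → Carrier → Fin N → Carrier
  conj N γ i = pow γ (2 ^ toℕ i)

  NormalElt : ℕ → Set (c ⊔ ℓ)
  NormalElt N = Σ Carrier λ γ → IsGF2Basis (conj N γ)

  SameBasis : {N : ℕ} → NormalElt N → NormalElt N → Set ℓ
  SameBasis {N} (γ , _) (γ′ , _) =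
    (∀ (i : Fin N) → Σ (Fin N) λ j → conj N γ i ≈ conj N γ′ j)
    × (∀ (j : Fin N) → Σ (Fin N) λ i → conj N γ′ j ≈ conj N γ i)

{-# OPTIONS --safe #-}

-- All three sets are counted by #trees d = 2^(2^d - d - 1), the number of spanning trees of the de Bruijn graph
-- on words of length d that are directed towards 0^d.
--
-- Trees. The vertices 0s and 1s ("twins") have the same two successors s0 and s1. Fixing the choices of all other
-- vertices, the number of choices at 1s that give a tree is the same whether 0s must choose differently from 1s
-- or must choose alike. Applied to all pairs of twins in turn, this identifies the trees with any prescribed pattern of
-- agreement between twins with those where all twins agree, that is, with the trees on words one letter shorter.
-- Full disagreement means that the successor map is a Hamiltonian cycle, i.e. a de Bruijn word of order one more
-- than the length of s; summing over all patterns gives a recursion for the number of trees.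
--
-- Odd words. Folding a word of length 2^d onto half its length by x_i + x_(i+h) keeps its parity, so an odd
-- word has no proper period; rotation acts freely and the number of necklaces is 2^(2^d - 1) / 2^d.
--
-- Normal bases. By the same folding, a linear relation between the conjugates of γ forces the trace of γ to vanish, so γ is
-- normal iff its trace is nonzero. Fix such a γ; the combination of its conjugates with coefficients w has trace
-- (number of ones of w) · tr γ, and rotating w amounts to applying a power of the Frobenius map.
module Submission where

open import Defs
open import Level using (Level)
import Algebra.Properties.CommutativeMonoid.Sum as CommutativeMonoidSum
import Algebra.Solver.Ring.NaturalCoefficients.Default as SemiringSolver
open import Data.Bool using (Bool; true; false; not; _∧_; _xor_; if_then_else_)
import Data.Bool.Properties as BoolP
open import Data.Fin using (Fin; zero; suc; toℕ; inject₁; fromℕ<; inject≤; combine; remQuot; funToFin; finToFun)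
open import Data.Fin.Permutation using (Permutation; permutation)
import Data.Fin.Properties as FinP
open import Data.List using (List; []; _∷_; map; _++_)
open import Data.List.Membership.Propositional using (_∈_)
import Data.List.Membership.Propositional.Properties as Mem
open import Data.List.Relation.Unary.Any using (here; there)
open import Data.Nat using (ℕ; zero; suc; pred; _+_; _*_; _∸_; _^_; _%_; _/_; _≤_; _<_; _≥_; z≤n; s≤s; NonZero)
open import Data.Nat.DivMod using (_mod_)
import Data.Nat.DivMod as DM
open import Data.Nat.Induction using (<-wellFounded)
import Data.Nat.Properties as ℕP
open import Data.Product using (Σ; Σ-syntax; _×_; _,_; proj₁; proj₂)
open import Data.Sum using (_⊎_; inj₁; inj₂) renaming (map to ⊎-map)
open import Data.Vec using (Vec; []; _∷_; head; tail; _∷ʳ_; replicate; lookup; tabulate)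
import Data.Vec.Properties as VecP
open import Function using (_∘_; id; case_of_)
open import Function.Bundles using (Bijection)
open import Induction.WellFounded using (Acc; acc)
open import Relation.Binary using (IsEquivalence)
open import Relation.Binary.Definitions using (Tri; tri<; tri≈; tri>)
open import Relation.Binary.PropositionalEquality using (_≡_; _≢_; _≗_; refl; sym; trans; cong; cong₂; subst; module ≡-Reasoning)
open import Relation.Nullary using (¬_; Dec; yes; no; contradiction)
open import Relation.Nullary.Decidable using (map′; _×-dec_)

-- Bijections of quotients and finite counting.

module _ {a b r s} {A : Set a} {_~_ : A → A → Set r} {B : Set b} {_≈_ : B → B → Set s} where

  QuotBij-sym : IsEquivalence _≈_ → QuotBij A _~_ B _≈_ → QuotBij B _≈_ A _~_
  QuotBij-sym E Q = record
    { to      = λ z → proj₁ (to-surj z)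
    ; to-cong = λ {z} {z′} p →
        to-inj (E.trans (proj₂ (to-surj z)) (E.trans p (E.sym (proj₂ (to-surj z′)))))
    ; to-inj  = λ {z} {z′} p →
        E.trans (E.sym (proj₂ (to-surj z))) (E.trans (to-cong p) (proj₂ (to-surj z′)))
    ; to-surj = λ x → to x , to-inj (proj₂ (to-surj (to x)))
    }
    where
    open QuotBij Q
    module E = IsEquivalence E

  QuotBij-trans : ∀ {c t} {C : Set c} {_≋_ : C → C → Set t} → IsEquivalence _≋_ →
    QuotBij A _~_ B _≈_ → QuotBij B _≈_ C _≋_ → QuotBij A _~_ C _≋_
  QuotBij-trans E P Q = record
    { to      = Q.to ∘ P.to
    ; to-cong = Q.to-cong ∘ P.to-cong
    ; to-inj  = P.to-inj ∘ Q.to-inj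
    ; to-surj = λ z → let y , q = Q.to-surj z ; x , p = P.to-surj y
                      in x , IsEquivalence.trans E (Q.to-cong p) q
    }
    where
    module P = QuotBij P
    module Q = QuotBij Q

≡-equiv : ∀ {a} {A : Set a} → IsEquivalence (_≡_ {A = A})
≡-equiv = record { refl = refl ; sym = sym ; trans = trans }

Enumerated : ∀ {a r} (A : Set a) → (A → A → Set r) → ℕ → Set _
Enumerated A _~_ n = QuotBij A _~_ (Fin n) _≡_

-- De Bruijn words and odd necklaces are matched in this way, by equal counts instead of an explicit
-- correspondence.
Enumerated⇒QuotBij : ∀ {a b r s} {A : Set a} {_~_ : A → A → Set r} {B : Set b} {_≈_ : B → B → Set s} {n} →
  IsEquivalence _≈_ → Enumerated A _~_ n → Enumerated B _≈_ n → QuotBij A _~_ B _≈_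
Enumerated⇒QuotBij E P Q = QuotBij-trans E P (QuotBij-sym ≡-equiv Q)

-- Induction on `n`: the element `zero` either joins the class of a later element, which leaves the
-- number of classes as it is, or opens a new class, which receives the number `zero`.
Fin-quotient : ∀ {r n} {_~_ : Fin n → Fin n → Set r} → IsEquivalence _~_ → (∀ i j → Dec (i ~ j)) →
  Σ ℕ (Enumerated (Fin n) _~_)
Fin-quotient {n = zero} E _≟_ = 0 , record
  { to = id ; to-cong = λ {} ; to-inj = λ {} ; to-surj = λ () }
Fin-quotient {n = suc n} {_~_} E _≟_
  with Fin-quotient {n = n} {λ i j → suc i ~ suc j}
         (record { refl = E.refl ; sym = E.sym ; trans = E.trans }) (λ i j → suc i ≟ suc j)
     | FinP.any? (λ j → zero ≟ suc j)
  where module E = IsEquivalence E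
... | k , Q | yes (j , 0~j) = k , record
  { to = to′ ; to-cong = λ {x} {y} → cong′ x y ; to-inj = λ {x} {y} → inj′ x y
  ; to-surj = λ z → suc (proj₁ (to-surj z)) , proj₂ (to-surj z) }
  where
  open QuotBij Q
  module E = IsEquivalence E
  to′ : Fin (suc n) → Fin k
  to′ zero    = to j
  to′ (suc i) = to i
  cong′ : ∀ x y → x ~ y → to′ x ≡ to′ y
  cong′ zero    zero    _ = refl
  cong′ zero    (suc y) p = to-cong (E.trans (E.sym 0~j) p)
  cong′ (suc x) zero    p = to-cong (E.trans p 0~j)
  cong′ (suc x) (suc y) p = to-cong p
  inj′ : ∀ x y → to′ x ≡ to′ y → x ~ y
  inj′ zero    zero    _ = E.refl
  inj′ zero    (suc y) p = E.trans 0~j (to-inj p)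
  inj′ (suc x) zero    p = E.trans (to-inj p) (E.sym 0~j)
  inj′ (suc x) (suc y) p = to-inj p
... | k , Q | no ¬0~ = suc k , record
  { to = to′ ; to-cong = λ {x} {y} → cong′ x y ; to-inj = λ {x} {y} → inj′ x y ; to-surj = surj′ }
  where
  open QuotBij Q
  module E = IsEquivalence E
  to′ : Fin (suc n) → Fin (suc k)
  to′ zero    = zero
  to′ (suc i) = suc (to i)
  cong′ : ∀ x y → x ~ y → to′ x ≡ to′ y
  cong′ zero    zero    _ = refl
  cong′ zero    (suc y) p = contradiction (y , p) ¬0~
  cong′ (suc x) zero    p = contradiction (x , E.sym p) ¬0~
  cong′ (suc x) (suc y) p = cong suc (to-cong p)
  inj′ : ∀ x y → to′ x ≡ to′ y → x ~ y
  inj′ zero    zero    _ = E.refl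
  inj′ (suc x) (suc y) p = to-inj (FinP.suc-injective p)
  surj′ : ∀ z → Σ (Fin (suc n)) λ x → to′ x ≡ z
  surj′ zero    = zero , refl
  surj′ (suc z) = suc (proj₁ (to-surj z)) , cong suc (proj₂ (to-surj z))

-- A missed value `y` could be put in front of the values of `f`, giving an injection of
-- `Fin (suc n)` into `Fin n`.
Fin-injective⇒surjective : ∀ {n} {f : Fin n → Fin n} → (∀ {i j} → f i ≡ f j → i ≡ j) →
  ∀ y → Σ (Fin n) λ x → f x ≡ y
Fin-injective⇒surjective {n} {f} inj y with FinP.any? (λ x → f x FinP.≟ y)
... | yes p = p
... | no ¬p = contradiction (FinP.injective⇒≤ {f = g} g-inj) ℕP.1+n≰n
  where
  g : Fin (suc n) → Fin n
  g zero    = y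
  g (suc x) = f x
  g-inj : ∀ {i j} → g i ≡ g j → i ≡ j
  g-inj {zero}  {zero}  _ = refl
  g-inj {zero}  {suc j} e = contradiction (j , sym e) ¬p
  g-inj {suc i} {zero}  e = contradiction (i , e) ¬p
  g-inj {suc i} {suc j} e = cong suc (inj e)

-- With a representative fixed in every class, an element amounts to its class together with the
-- index that carries the representative to it. The assignments in both directions are injective
-- maps of finite sets, so the sizes agree.
free-orbits : ∀ {a r s} {A : Set a} {_≈_ : A → A → Set r} {_~_ : A → A → Set s} {M N k} →
  IsEquivalence _≈_ → IsEquivalence _~_ →
  (act : Fin N → A → A) →
  (∀ i {x y} → x ≈ y → act i x ≈ act i y) →
  (∀ {x y} → x ~ y → Σ (Fin N) λ i → act i x ≈ y) →
  (∀ i x → act i x ~ x) → (∀ {x y} → x ≈ y → x ~ y) →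
  (∀ {i j} x → act i x ≈ act j x → i ≡ j) →
  Enumerated A _≈_ M → Enumerated A _~_ k → M ≡ k * N
free-orbits {A = A} {_≈_} {_~_} {M} {N} {k} E E~ act act-cong orbit act-~ ≈⇒~ free P Q =
  FinP.cantor-schröder-bernstein {f = f} {g} f-inj g-inj
  where
  module P = QuotBij P
  module Q = QuotBij Q
  module E = IsEquivalence E
  module E~ = IsEquivalence E~
  el : Fin M → A
  el i = proj₁ (P.to-surj i)
  rep : Fin k → A
  rep c = proj₁ (Q.to-surj c)
  offset : ∀ x → Σ (Fin N) λ i → act i (rep (Q.to x)) ≈ x
  offset x = orbit (Q.to-inj (proj₂ (Q.to-surj (Q.to x))))
  f : Fin M → Fin (k * N)
  f i = combine (Q.to (el i)) (proj₁ (offset (el i)))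
  f-inj : ∀ {i j} → f i ≡ f j → i ≡ j
  f-inj {i} {j} e with FinP.combine-injective (Q.to (el i)) _ (Q.to (el j)) _ e
  ... | p , q = trans (sym (proj₂ (P.to-surj i))) (trans (P.to-cong (E.trans (E.sym (proj₂ (offset (el i))))
                  (E.trans (E.reflexive (cong₂ (λ c o → act o (rep c)) p q)) (proj₂ (offset (el j)))))) (proj₂ (P.to-surj j)))
  h : Fin k × Fin N → Fin M
  h (c , i) = P.to (act i (rep c))
  h-inj : ∀ x y → h x ≡ h y → x ≡ y
  h-inj (c , i) (c′ , i′) e = cong₂ _,_ c≡c′
      (free (rep c) (E.trans (P.to-inj e) (E.reflexive (cong (act i′ ∘ rep) (sym c≡c′)))))
    where
    c≡c′ : c ≡ c′
    c≡c′ = trans (sym (proj₂ (Q.to-surj c))) (trans (Q.to-cong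
      (E~.trans (E~.sym (act-~ i (rep c))) (E~.trans (≈⇒~ (P.to-inj e)) (act-~ i′ (rep c′)))))
      (proj₂ (Q.to-surj c′)))
  g : Fin (k * N) → Fin M
  g = h ∘ remQuot N
  g-inj : ∀ {i j} → g i ≡ g j → i ≡ j
  g-inj {i} {j} e = trans (sym (FinP.combine-remQuot {k} N i))
    (trans (cong (λ p → combine (proj₁ p) (proj₂ p)) (h-inj _ _ e)) (FinP.combine-remQuot {k} N j))

Word-enumerated : ∀ n → Enumerated (Word n) _≗_ (2 ^ n)
Word-enumerated n = record
  { to      = λ w → funToFin (bit ∘ w)
  ; to-cong = λ p → funToFin-cong (cong bit ∘ p)
  ; to-inj  = λ {w} {w′} p i → bit-injective (trans (sym (FinP.finToFun-funToFin (bit ∘ w) i))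
                (trans (cong (λ c → finToFun c i) p) (FinP.finToFun-funToFin (bit ∘ w′) i)))
  ; to-surj = λ z → (λ i → unbit (finToFun {2} {n} z i)) ,
                trans (funToFin-cong (λ i → bit-unbit (finToFun {2} {n} z i))) (FinP.funToFin-finToFin {n} {2} z)
  }
  where
  bit : Bool → Fin 2
  bit false = zero
  bit true  = suc zero
  unbit : Fin 2 → Bool
  unbit zero    = false
  unbit (suc _) = true
  bit-unbit : ∀ i → bit (unbit i) ≡ i
  bit-unbit zero       = refl
  bit-unbit (suc zero) = refl
  bit-injective : ∀ {x y} → bit x ≡ bit y → x ≡ y
  bit-injective {false} {false} _ = refl
  bit-injective {true}  {true}  _ = refl
  funToFin-cong : ∀ {m} {f g : Fin m → Fin 2} → f ≗ g → funToFin f ≡ funToFin g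
  funToFin-cong {zero}  p = refl
  funToFin-cong {suc m} p = cong₂ combine (p zero) (funToFin-cong (p ∘ suc))

-- Positions modulo the length, and rotation.

toℕ-mod : ∀ k n .{{_ : NonZero n}} → toℕ (k mod n) ≡ k % n
toℕ-mod k n = FinP.toℕ-fromℕ< (DM.m%n<n k n)

mod-cong : ∀ {j k} n .{{_ : NonZero n}} → j % n ≡ k % n → j mod n ≡ k mod n
mod-cong {j} {k} n p = FinP.toℕ-injective (trans (toℕ-mod j n) (trans p (sym (toℕ-mod k n))))

toℕ-% : ∀ {n} .{{_ : NonZero n}} (i : Fin n) → toℕ i % n ≡ toℕ i
toℕ-% i = DM.m<n⇒m%n≡m (FinP.toℕ<n i)

toℕ-⊕ : ∀ {n} .{{_ : NonZero n}} (i : Fin n) k → toℕ (i ⊕ k) ≡ (toℕ i + k) % n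
toℕ-⊕ {suc n} i k = toℕ-mod (toℕ i + k) (suc n)

⊕≡mod : ∀ {n} .{{_ : NonZero n}} (i : Fin n) k → i ⊕ k ≡ (toℕ i + k) mod n
⊕≡mod {suc n} i k = refl

mod-toℕ : ∀ {n} .{{_ : NonZero n}} (i : Fin n) → toℕ i mod n ≡ i
mod-toℕ {n} i = FinP.toℕ-injective (trans (toℕ-mod (toℕ i) n) (toℕ-% i))

%-+ˡ : ∀ m k n .{{_ : NonZero n}} → (m % n + k) % n ≡ (m + k) % n
%-+ˡ m k n = trans (DM.%-distribˡ-+ (m % n) k n)
  (trans (cong (λ z → (z + k % n) % n) (DM.m%n%n≡m%n m n)) (sym (DM.%-distribˡ-+ m k n)))

mod-⊕ : ∀ m k n .{{_ : NonZero n}} → (m mod n) ⊕ k ≡ (m + k) mod n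
mod-⊕ m k n = trans (⊕≡mod (m mod n) k) (mod-cong n
  (trans (cong (λ z → (z + k) % n) (toℕ-mod m n)) (%-+ˡ m k n)))

⊕-⊕ : ∀ {n} .{{_ : NonZero n}} (i : Fin n) j k → (i ⊕ j) ⊕ k ≡ i ⊕ (j + k)
⊕-⊕ {n} i j k = trans (cong (_⊕ k) (⊕≡mod i j)) (trans (mod-⊕ (toℕ i + j) k n)
  (trans (cong (_mod n) (ℕP.+-assoc (toℕ i) j k)) (sym (⊕≡mod i (j + k)))))

⊕-0 : ∀ {n} .{{_ : NonZero n}} (i : Fin n) → i ⊕ 0 ≡ i
⊕-0 {n} i = trans (⊕≡mod i 0) (trans (cong (_mod n) (ℕP.+-identityʳ (toℕ i))) (mod-toℕ i))

⊕-period : ∀ {n} .{{_ : NonZero n}} (i : Fin n) k → k % n ≡ 0 → i ⊕ k ≡ i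
⊕-period {n} i k p = trans (⊕≡mod i k) (trans (mod-cong n
  (trans (DM.%-distribˡ-+ (toℕ i) k n) (trans (cong (λ z → (toℕ i % n + z) % n) p)
  (trans (cong (_% n) (ℕP.+-identityʳ (toℕ i % n))) (DM.m%n%n≡m%n (toℕ i) n))))) (mod-toℕ i))

-- A complement of k modulo n that needs no subtraction.
neg : ℕ → ℕ → ℕ
neg n k = k * pred n

+-neg : ∀ n k .{{_ : NonZero n}} → (k + neg n k) % n ≡ 0
+-neg (suc n) k = trans (cong (_% suc n) (sym (ℕP.*-suc k n))) (DM.m*n%n≡0 k (suc n))

neg-+ : ∀ n k .{{_ : NonZero n}} → (neg n k + k) % n ≡ 0
neg-+ n k = trans (cong (_% n) (ℕP.+-comm (neg n k) k)) (+-neg n k)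

⊕-shift : ∀ {n} .{{_ : NonZero n}} (i j : Fin n) → Σ ℕ λ k → i ⊕ k ≡ j
⊕-shift {n} i j = neg n (toℕ i) + toℕ j , trans (⊕≡mod i _) (trans (mod-cong n (begin
    (toℕ i + (neg n (toℕ i) + toℕ j)) % n  ≡⟨ cong (_% n) (ℕP.+-assoc (toℕ i) _ _) ⟨
    (toℕ i + neg n (toℕ i) + toℕ j) % n    ≡⟨ %-+ˡ (toℕ i + neg n (toℕ i)) (toℕ j) n ⟨
    ((toℕ i + neg n (toℕ i)) % n + toℕ j) % n ≡⟨ cong (λ z → (z + toℕ j) % n) (+-neg n (toℕ i)) ⟩
    toℕ j % n ∎)) (mod-toℕ j))
  where open ≡-Reasoning

∼ₙ-equiv : ∀ {n} .{{_ : NonZero n}} → IsEquivalence (_∼ₙ_ {n})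
∼ₙ-equiv {n} = record
  { refl  = λ {w} → 0 , λ i → cong w (sym (⊕-0 i))
  ; sym   = λ {w} {w′} (k , p) → neg n k , λ i → sym (trans (p (i ⊕ neg n k))
      (cong w (trans (⊕-⊕ i (neg n k) k) (⊕-period i (neg n k + k) (neg-+ n k)))))
  ; trans = λ {w} {w′} {w″} (j , p) (k , q) → k + j , λ i →
      trans (q i) (trans (p (i ⊕ k)) (cong w (⊕-⊕ i k j)))
  }

-- Parity of periodic binary sequences.

parity : ℕ → (ℕ → Bool) → Bool
parity zero    f = false
parity (suc n) f = f 0 xor parity n (f ∘ suc)

parity-cong : ∀ n {f g} → f ≗ g → parity n f ≡ parity n g
parity-cong zero    p = refl
parity-cong (suc n) p = cong₂ _xor_ (p 0) (parity-cong n (p ∘ suc))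

parity-+ : ∀ m n f → parity (m + n) f ≡ parity m f xor parity n (f ∘ (m +_))
parity-+ zero    n f = refl
parity-+ (suc m) n f = trans (cong (f 0 xor_) (parity-+ m n (f ∘ suc)))
  (sym (BoolP.xor-assoc (f 0) _ _))

xor-interchange : ∀ a b c d → (a xor b) xor (c xor d) ≡ (a xor c) xor (b xor d)
xor-interchange a b c d = begin
  (a xor b) xor (c xor d) ≡⟨ BoolP.xor-assoc a b _ ⟩
  a xor (b xor (c xor d)) ≡⟨ cong (a xor_) (BoolP.xor-assoc b c d) ⟨
  a xor ((b xor c) xor d) ≡⟨ cong (λ z → a xor (z xor d)) (BoolP.xor-comm b c) ⟩
  a xor ((c xor b) xor d) ≡⟨ cong (a xor_) (BoolP.xor-assoc c b d) ⟩
  a xor (c xor (b xor d)) ≡⟨ BoolP.xor-assoc a c _ ⟨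
  (a xor c) xor (b xor d) ∎
  where open ≡-Reasoning

parity-xor : ∀ n f g → parity n (λ i → f i xor g i) ≡ parity n f xor parity n g
parity-xor zero    f g = refl
parity-xor (suc n) f g = trans (cong ((f 0 xor g 0) xor_) (parity-xor n (f ∘ suc) (g ∘ suc)))
  (xor-interchange (f 0) (g 0) _ _)

parity-false : ∀ n {f} → (∀ i → f i ≡ false) → parity n f ≡ false
parity-false zero    p = refl
parity-false (suc n) p = cong₂ _xor_ (p 0) (parity-false n (p ∘ suc))

parity-suc : ∀ n f → parity (suc n) f ≡ parity n f xor f n
parity-suc zero    f = BoolP.xor-identityʳ (f 0)
parity-suc (suc n) f = trans (cong (f 0 xor_) (parity-suc n (f ∘ suc))) (sym (BoolP.xor-assoc (f 0) _ _))

-- Shifting by one removes the term `f 0` and adds `f n`, which is equal to it by periodicity.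
parity-shift : ∀ n k f → (∀ i → f (i + n) ≡ f i) → parity n (f ∘ (_+ k)) ≡ parity n f
parity-shift n zero    f per = parity-cong n (cong f ∘ ℕP.+-identityʳ)
parity-shift n (suc k) f per = trans (parity-cong n (λ i → cong f (ℕP.+-suc i k)))
  (trans (parity-shift n k (f ∘ suc) (per ∘ suc)) (xor-cancel (f 0) (begin
    f 0 xor parity n (f ∘ suc) ≡⟨ parity-suc n f ⟩
    parity n f xor f n         ≡⟨ cong (parity n f xor_) (per 0) ⟩
    parity n f xor f 0         ≡⟨ BoolP.xor-comm (parity n f) (f 0) ⟩
    f 0 xor parity n f         ∎)))
  where
  open ≡-Reasoning
  xor-cancel : ∀ a {b c} → a xor b ≡ a xor c → b ≡ c
  xor-cancel false p = p
  xor-cancel true  p = BoolP.not-injective p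

-- Folding f to c i = f i xor f (i + h), h half the length, keeps the parity and every period
-- and makes h itself a period; a period equal to h makes c vanish.
parity-periodic : ∀ d k f → 0 < k → k < 2 ^ d → (∀ i → f (i + 2 ^ d) ≡ f i) → (∀ i → f (i + k) ≡ f i) →
  parity (2 ^ d) f ≡ false
parity-periodic zero    (suc k) f _ (s≤s ()) _ _
parity-periodic (suc d) k f 0<k k<2h per₂ₕ perₖ = begin
  parity (h + (h + 0)) f               ≡⟨ cong (λ z → parity (h + z) f) (ℕP.+-identityʳ h) ⟩
  parity (h + h) f                     ≡⟨ parity-+ h h f ⟩
  parity h f xor parity h (f ∘ (h +_)) ≡⟨ parity-xor h f (f ∘ (h +_)) ⟨
  parity h c                           ≡⟨ folded (ℕP.<-cmp k h) ⟩
  false                                ∎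
  where
  open ≡-Reasoning
  h = 2 ^ d
  c : ℕ → Bool
  c i = f i xor f (h + i)
  shift-h : ∀ i → f (h + (i + h)) ≡ f i
  shift-h i = trans (cong f (begin
    h + (i + h)       ≡⟨ ℕP.+-comm h (i + h) ⟩
    i + h + h         ≡⟨ ℕP.+-assoc i h h ⟩
    i + (h + h)       ≡⟨ cong (λ z → i + (h + z)) (ℕP.+-identityʳ h) ⟨
    i + (h + (h + 0)) ∎)) (per₂ₕ i)
  c-per : ∀ i → c (i + h) ≡ c i
  c-per i = trans (cong₂ _xor_ (cong f (ℕP.+-comm i h)) (shift-h i)) (BoolP.xor-comm (f (h + i)) (f i))
  c-perₖ : ∀ i → c (i + k) ≡ c i
  c-perₖ i = cong₂ _xor_ (perₖ i) (trans (cong f (sym (ℕP.+-assoc h i k))) (perₖ (h + i)))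
  folded : Tri (k < h) (k ≡ h) (h < k) → parity h c ≡ false
  folded (tri< k<h _ _)  = parity-periodic d k c 0<k k<h c-per c-perₖ
  folded (tri≈ _ refl _) = parity-false h λ i →
    trans (cong (f i xor_) (trans (cong f (ℕP.+-comm h i)) (perₖ i))) (BoolP.xor-same (f i))
  folded (tri> _ _ h<k)  = parity-periodic d k′ c (ℕP.m<n⇒0<n∸m h<k) k′<h c-per c-perₖ′
    where
    k′ = k ∸ h
    k′+h : k′ + h ≡ k
    k′+h = ℕP.m∸n+n≡m (ℕP.<⇒≤ h<k)
    k′<h : k′ < h
    k′<h = ℕP.+-cancelʳ-< h k′ h (subst (_< h + h) (sym k′+h)
             (subst (k <_) (cong (h +_) (ℕP.+-identityʳ h)) k<2h))
    c-perₖ′ : ∀ i → c (i + k′) ≡ c i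
    c-perₖ′ i = trans (sym (c-per (i + k′))) (trans (cong c (trans (ℕP.+-assoc i k′ h) (cong (i +_) k′+h))) (c-perₖ i))

-- Odd words and the number of their necklaces.

-- The periodic extension to all natural positions turns a rotation into a plain shift of the
-- argument, as `extend-shift` records.
extend : ∀ {n} .{{_ : NonZero n}} → Word n → ℕ → Bool
extend {n} w k = w (k mod n)

extend-periodic : ∀ {n} .{{_ : NonZero n}} (w : Word n) i → extend w (i + n) ≡ extend w i
extend-periodic {n} w i = cong w (mod-cong n (DM.[m+n]%n≡m%n i n))

extend-shift : ∀ {n} .{{_ : NonZero n}} (w : Word n) k i → extend (λ j → w (j ⊕ k)) i ≡ extend w (i + k)
extend-shift {n} w k i = cong w (mod-⊕ i k n)

odd? : ℕ → Bool
odd? zero    = false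
odd? (suc n) = not (odd? n)

%2≡1⇒odd : ∀ n → n % 2 ≡ 1 → odd? n ≡ true
%2≡1⇒odd (suc zero)    _ = refl
%2≡1⇒odd (suc (suc n)) p = trans (BoolP.not-involutive (odd? n)) (%2≡1⇒odd n (trans (sym (DM.[m+n]%n≡m%n n 2)) (trans (cong (_% 2) (ℕP.+-comm n 2)) p)))

odd⇒%2≡1 : ∀ n → odd? n ≡ true → n % 2 ≡ 1
odd⇒%2≡1 (suc zero)    _ = refl
odd⇒%2≡1 (suc (suc n)) p = trans (cong (_% 2) (ℕP.+-comm 2 n)) (trans (DM.[m+n]%n≡m%n n 2) (odd⇒%2≡1 n (trans (sym (BoolP.not-involutive (odd? n))) p)))

odd-ones : ∀ {n} (w : Word n) (f : ℕ → Bool) → (∀ i → w i ≡ f (toℕ i)) → odd? (ones w) ≡ parity n f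
odd-ones {zero}  w f p = refl
odd-ones {suc n} w f p with w zero | p zero
... | true  | q = trans (cong not (odd-ones (w ∘ suc) (f ∘ suc) (p ∘ suc))) (cong (_xor parity n (f ∘ suc)) q)
... | false | q = trans (odd-ones (w ∘ suc) (f ∘ suc) (p ∘ suc)) (cong (_xor parity n (f ∘ suc)) q)

odd-ones-extend : ∀ {n} .{{_ : NonZero n}} (w : Word n) → odd? (ones w) ≡ parity n (extend w)
odd-ones-extend w = odd-ones w (extend w) (λ i → cong w (sym (mod-toℕ i)))

rotate : ∀ {n} .{{_ : NonZero n}} → ℕ → OddWord n → OddWord n
rotate {n} k (w , odd) = (λ i → w (i ⊕ k)) , odd⇒%2≡1 (ones (λ i → w (i ⊕ k))) (begin
  odd? (ones (λ i → w (i ⊕ k)))       ≡⟨ odd-ones-extend (λ i → w (i ⊕ k)) ⟩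
  parity n (extend (λ i → w (i ⊕ k))) ≡⟨ parity-cong n (extend-shift w k) ⟩
  parity n (extend w ∘ (_+ k))        ≡⟨ parity-shift n k (extend w) (extend-periodic w) ⟩
  parity n (extend w)                 ≡⟨ odd-ones-extend w ⟨
  odd? (ones w)                       ≡⟨ %2≡1⇒odd (ones w) odd ⟩
  true                                ∎)
  where open ≡-Reasoning

_≈Odd_ : ∀ {n} → OddWord n → OddWord n → Set
(w , _) ≈Odd (w′ , _) = w ≗ w′

-- All letters after the first are free, and the parity condition then forces the first one.
OddWord-enumerated : ∀ n → Enumerated (OddWord (suc n)) _≈Odd_ (2 ^ n)
OddWord-enumerated n = QuotBij-trans ≡-equiv (record
  { to      = λ (w , _) → w ∘ suc
  ; to-cong = λ p i → p (suc i)
  ; to-inj  = λ {x} {y} p → λ { zero → heads x y p ; (suc i) → p i }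
  ; to-surj = λ z → (cons z , cons-odd z) , λ _ → refl
  }) (Word-enumerated n)
  where
  ones-cong : ∀ {m} {w w′ : Word m} → w ≗ w′ → ones w ≡ ones w′
  ones-cong {zero}  p = refl
  ones-cong {suc m} p = cong₂ _+_ (cong (λ b → if b then 1 else 0) (p zero)) (ones-cong (p ∘ suc))
  odd-cons : ∀ b k → odd? ((if b then 1 else 0) + k) ≡ b xor odd? k
  odd-cons false k = refl
  odd-cons true  k = refl
  cons : Word n → Word (suc n)
  cons z zero    = not (odd? (ones z))
  cons z (suc i) = z i
  cons-odd : ∀ z → ones (cons z) % 2 ≡ 1
  cons-odd z = odd⇒%2≡1 (ones (cons z)) (trans (odd-cons (not (odd? (ones z))) (ones z)) (not-xor (odd? (ones z))))
    where not-xor : ∀ b → not b xor b ≡ true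
          not-xor false = refl
          not-xor true  = refl
  heads : ∀ (x y : OddWord (suc n)) → (∀ i → proj₁ x (suc i) ≡ proj₁ y (suc i)) → proj₁ x zero ≡ proj₁ y zero
  heads (w , p) (w′ , q) eq = xor-injˡ (w zero) (w′ zero) (odd? (ones (w ∘ suc)))
    (trans (sym (odd-cons (w zero) (ones (w ∘ suc)))) (trans (%2≡1⇒odd (ones w) p) (trans (sym (%2≡1⇒odd (ones w′) q))
    (trans (odd-cons (w′ zero) (ones (w′ ∘ suc))) (cong (λ k → w′ zero xor odd? k) (sym (ones-cong eq)))))))
    where
    xor-injˡ : ∀ a b c → a xor c ≡ b xor c → a ≡ b
    xor-injˡ false false c p = refl
    xor-injˡ true  true  c p = refl
    xor-injˡ false true  c p = contradiction p (BoolP.not-¬ refl)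
    xor-injˡ true  false c p = contradiction (sym p) (BoolP.not-¬ refl)

≈Odd-equiv : ∀ {n} → IsEquivalence (_≈Odd_ {n})
≈Odd-equiv = record
  { refl = λ _ → refl ; sym = λ p i → sym (p i) ; trans = λ p q i → trans (p i) (q i) }

∼Odd-equiv : ∀ {n} .{{_ : NonZero n}} → IsEquivalence (_∼Odd_ {n})
∼Odd-equiv = record
  { refl  = λ {x} → E.refl {proj₁ x}
  ; sym   = λ {x} {y} → E.sym {proj₁ x} {proj₁ y}
  ; trans = λ {x} {y} {z} → E.trans {proj₁ x} {proj₁ y} {proj₁ z} }
  where
  module E = IsEquivalence ∼ₙ-equiv

⊕-% : ∀ {n} .{{_ : NonZero n}} (i : Fin n) k → i ⊕ k ≡ i ⊕ (k % n)
⊕-% {n} i k = trans (⊕≡mod i k) (trans (mod-cong n (begin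
    (toℕ i + k) % n           ≡⟨ DM.%-distribˡ-+ (toℕ i) k n ⟩
    (toℕ i % n + k % n) % n   ≡⟨ %-+ˡ (toℕ i) (k % n) n ⟩
    (toℕ i + k % n) % n       ∎)) (sym (⊕≡mod i (k % n))))
  where open ≡-Reasoning

extend-% : ∀ {n} .{{_ : NonZero n}} (w : Word n) i k → k % n ≡ 0 → extend w (i + k) ≡ extend w i
extend-% {n} w i k p = cong w (trans (sym (mod-⊕ i k n)) (⊕-period (i mod n) k p))

-- A shift may be reduced modulo `n`, so finitely many shifts have to be tested.
_∼ₙ?_ : ∀ {n} .{{_ : NonZero n}} (w w′ : Word n) → Dec (w ∼ₙ w′)
_∼ₙ?_ {n} w w′ = map′
  (λ (k , p) → toℕ k , p)
  (λ (k , p) → k mod n , λ i → trans (p i) (cong w (trans (⊕-% i k) (cong (i ⊕_) (sym (toℕ-mod k n))))))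
  (FinP.any? {n = n} (λ k → FinP.all? (λ i → w′ i BoolP.≟ w (i ⊕ toℕ k))))

module _ (d : ℕ) where

  private instance
    2^d≢0 : NonZero (2 ^ d)
    2^d≢0 = ℕP.m^n≢0 2 d

  -- Equal rotations by `i` and `j` make the difference `j - i` a period of the word. It is positive
  -- and below the length, so `parity-periodic` would make the number of ones even.
  no-short-period : ∀ (x : OddWord (2 ^ d)) {i j : Fin (2 ^ d)} → toℕ i < toℕ j →
    ¬ (rotate (toℕ i) x ≈Odd rotate (toℕ j) x)
  no-short-period (w , odd) {i} {j} i<j p = contradiction
    (trans (sym (%2≡1⇒odd (ones w) odd)) (trans (odd-ones-extend w)
      (parity-periodic d k f (ℕP.m<n⇒0<n∸m i<j) (ℕP.≤-<-trans (ℕP.m∸n≤m (toℕ j) (toℕ i)) (FinP.toℕ<n j))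
        (extend-periodic w) period)))
    λ ()
    where
    open ≡-Reasoning
    f = extend w
    k = toℕ j ∸ toℕ i
    shifts : ∀ x → f (x + toℕ i) ≡ f (x + toℕ j)
    shifts x = trans (sym (extend-shift w (toℕ i) x)) (trans (p (x mod 2 ^ d)) (extend-shift w (toℕ j) x))
    -- This undoes the rotation by `i`: `back + toℕ i` is a multiple of the length and may be added
    -- to any position.
    back = neg (2 ^ d) (toℕ i)
    period : ∀ x → f (x + k) ≡ f x
    period x = begin
      f (x + k)                   ≡⟨ extend-% w (x + k) (back + toℕ i) (neg-+ (2 ^ d) (toℕ i)) ⟨
      f (x + k + (back + toℕ i))  ≡⟨ cong f (begin
        x + k + (back + toℕ i)    ≡⟨ ℕP.+-assoc x k _ ⟩
        x + (k + (back + toℕ i))  ≡⟨ cong (x +_) (ℕP.+-comm k _) ⟩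
        x + (back + toℕ i + k)    ≡⟨ cong (x +_) (ℕP.+-assoc back (toℕ i) k) ⟩
        x + (back + (toℕ i + k))  ≡⟨ cong (λ z → x + (back + z)) (ℕP.m+[n∸m]≡n (ℕP.<⇒≤ i<j)) ⟩
        x + (back + toℕ j)        ≡⟨ ℕP.+-assoc x back _ ⟨
        x + back + toℕ j          ∎) ⟩
      f (x + back + toℕ j)        ≡⟨ shifts (x + back) ⟨
      f (x + back + toℕ i)        ≡⟨ cong f (ℕP.+-assoc x back _) ⟩
      f (x + (back + toℕ i))      ≡⟨ extend-% w x (back + toℕ i) (neg-+ (2 ^ d) (toℕ i)) ⟩
      f x                         ∎

  rotations-distinct : ∀ (x : OddWord (2 ^ d)) {i j : Fin (2 ^ d)} →
    rotate (toℕ i) x ≈Odd rotate (toℕ j) x → i ≡ j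
  rotations-distinct x {i} {j} p with ℕP.<-cmp (toℕ i) (toℕ j)
  ... | tri≈ _ eq _  = FinP.toℕ-injective eq
  ... | tri< i<j _ _ = contradiction p (no-short-period x i<j)
  ... | tri> _ _ j<i = contradiction (sym ∘ p) (no-short-period x j<i)

  -- Rotation equivalence is decidable, so the necklaces can be counted on the enumerated words; `k`
  -- is the number found. Since the rotations of an odd word are distinct, `free-orbits` yields the
  -- equation that later determines `k`.
  OddWord-necklaces-enumerated :
    Σ ℕ λ k → Enumerated (OddWord (2 ^ d)) _∼Odd_ k × 2 ^ pred (2 ^ d) ≡ k * 2 ^ d
  OddWord-necklaces-enumerated = k , necklaces ,
    free-orbits {N = N} ≈Odd-equiv ∼Odd-equiv (λ i → rotate (toℕ i)) (λ i p j → p (j ⊕ toℕ i))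
      (λ {(w , _)} {(w′ , _)} (m , p) → m mod N , λ i →
        trans (cong w (trans (cong (i ⊕_) (toℕ-mod m N)) (sym (⊕-% i m)))) (sym (p i)))
      (λ i x → IsEquivalence.sym ∼Odd-equiv {x} {rotate (toℕ i) x} (toℕ i , λ _ → refl))
      (λ {x} {y} → ≈⇒∼ {x} {y}) (λ {i} {j} x → rotations-distinct x {i} {j}) words necklaces
    where
    N = 2 ^ d
    words : Enumerated (OddWord N) _≈Odd_ (2 ^ pred N)
    words = subst (λ n → Enumerated (OddWord n) _≈Odd_ (2 ^ pred N)) (ℕP.suc-pred N) (OddWord-enumerated (pred N))
    module W = QuotBij words
    el : Fin (2 ^ pred N) → OddWord N
    el i = proj₁ (W.to-surj i)
    ≈⇒∼ : ∀ {x y : OddWord N} → x ≈Odd y → x ∼Odd y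
    ≈⇒∼ {w , _} p = 0 , λ i → trans (sym (p i)) (cong w (sym (⊕-0 i)))
    ∼-on-el : IsEquivalence (λ i j → el i ∼Odd el j)
    ∼-on-el = record
      { refl  = λ {i} → E.refl {el i}
      ; sym   = λ {i} {j} → E.sym {el i} {el j}
      ; trans = λ {i} {j} {k} → E.trans {el i} {el j} {el k} }
      where
        module E = IsEquivalence (∼Odd-equiv {N})
    quotient : Σ ℕ (Enumerated (Fin (2 ^ pred N)) (λ i j → el i ∼Odd el j))
    quotient = Fin-quotient ∼-on-el (λ i j → proj₁ (el i) ∼ₙ? proj₁ (el j))
    k = proj₁ quotient
    module Q = QuotBij (proj₂ quotient)
    el∼ : ∀ x → el (W.to x) ∼Odd x
    el∼ x = ≈⇒∼ {el (W.to x)} {x} (W.to-inj {el (W.to x)} {x} (proj₂ (W.to-surj (W.to x))))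
    necklaces : Enumerated (OddWord N) _∼Odd_ k
    necklaces = record
      { to      = Q.to ∘ W.to
      ; to-cong = λ {x} {y} p → Q.to-cong (E.trans {el (W.to x)} {x} {el (W.to y)} (el∼ x) (E.trans {x} {y} {el (W.to y)} p (E.sym {el (W.to y)} {y} (el∼ y))))
      ; to-inj  = λ {x} {y} p → E.trans {x} {el (W.to x)} {y} (E.sym {el (W.to x)} {x} (el∼ x))
                    (E.trans {el (W.to x)} {el (W.to y)} {y} (Q.to-inj p) (el∼ y))
      ; to-surj = λ z → let i , p = Q.to-surj z in el i , trans (cong Q.to (proj₂ (W.to-surj i))) p
      }
      where
        module E = IsEquivalence (∼Odd-equiv {N})

-- Iteration of a map and trees directed towards a root.

module _ {a} {V : Set a} where

  iterate : (V → V) → ℕ → V → V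
  iterate n zero    v = v
  iterate n (suc k) v = iterate n k (n v)

  iterate-+ : ∀ n j k v → iterate n (j + k) v ≡ iterate n k (iterate n j v)
  iterate-+ n zero    k v = refl
  iterate-+ n (suc j) k v = iterate-+ n j k (n v)

  iterate-cong : ∀ {n n′} → n ≗ n′ → ∀ k v → iterate n k v ≡ iterate n′ k v
  iterate-cong p zero    v = refl
  iterate-cong {n′ = n′} p (suc k) v = trans (iterate-cong p k _) (cong (iterate n′ k) (p v))

  Reaches : V → (V → V) → V → Set a
  Reaches ρ n v = Σ ℕ λ k → iterate n k v ≡ ρ

  IsTree : V → (V → V) → Set a
  IsTree ρ n = ∀ v → Reaches ρ n v

  reaches-step : ∀ {ρ n v v′} → n v ≡ v′ → Reaches ρ n v′ → Reaches ρ n v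
  reaches-step refl (k , p) = suc k , p

  IsTree-cong : ∀ {ρ n n′} → n ≗ n′ → IsTree ρ n → IsTree ρ n′
  IsTree-cong p t v = proj₁ (t v) , trans (sym (iterate-cong p (proj₁ (t v)) v)) (proj₂ (t v))

  module _ (_≟_ : ∀ (v w : V) → Dec (v ≡ w)) where

    -- A path can be cut at its first arrival at the root, before any edge leaving the root is
    -- followed.
    IsTree-offRoot : ∀ {ρ n n′} → (∀ v → v ≢ ρ → n v ≡ n′ v) → IsTree ρ n → IsTree ρ n′
    IsTree-offRoot {ρ} {n} {n′} p t v = go (proj₁ (t v)) v (proj₂ (t v))
      where
      go : ∀ k v → iterate n k v ≡ ρ → Reaches ρ n′ v
      go zero    v q = 0 , q
      go (suc k) v q with v ≟ ρ
      ... | yes v≡ρ = 0 , v≡ρ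
      ... | no  v≢ρ = reaches-step (sym (p v v≢ρ)) (go k (n v) q)

    -- The vertex wanted is the one just before the first arrival at the root.
    last-step : ∀ {ρ n v} → v ≢ ρ → Reaches ρ n v → Σ V λ v′ → v′ ≢ ρ × n v′ ≡ ρ
    last-step {ρ} {n} v≢ρ (k , q) = go k v≢ρ q
      where
      go : ∀ k {v} → v ≢ ρ → iterate n k v ≡ ρ → Σ V λ v′ → v′ ≢ ρ × n v′ ≡ ρ
      go zero        v≢ρ q = contradiction q v≢ρ
      go (suc k) {v} v≢ρ q with n v ≟ ρ
      ... | yes e = v , v≢ρ , e
      ... | no ne = go k ne q

    module _ {K} (code : V → Fin K) (code-inj : ∀ {v w} → code v ≡ code w → v ≡ w) where

      -- A path of more than `K` steps repeats a vertex among its first `K + 1` points, and the loop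
      -- in between can be cut out. This bounds the search in `reaches?`.
      shorten : ∀ n k v → Acc _<_ k → Σ ℕ λ j → j < suc K × iterate n j v ≡ iterate n k v
      shorten n k v (acc rs) with ℕP.≤-<-connex k K
      ... | inj₁ k≤K = k , s≤s k≤K , refl
      ... | inj₂ K<k with FinP.pigeonhole (ℕP.n<1+n K) (λ (i : Fin (suc K)) → code (iterate n (toℕ i) v))
      ... | i , j , i<j , e =
        let l , l≤K , q = shorten n k′ v (rs k′<k) in l , l≤K , trans q (begin
          iterate n (toℕ i + (k ∸ toℕ j)) v            ≡⟨ iterate-+ n (toℕ i) _ v ⟩
          iterate n (k ∸ toℕ j) (iterate n (toℕ i) v)  ≡⟨ cong (iterate n (k ∸ toℕ j)) (code-inj e) ⟩
          iterate n (k ∸ toℕ j) (iterate n (toℕ j) v)  ≡⟨ iterate-+ n (toℕ j) _ v ⟨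
          iterate n (toℕ j + (k ∸ toℕ j)) v            ≡⟨ cong (λ z → iterate n z v) j+ ⟩
          iterate n k v                                ∎)
        where
        open ≡-Reasoning
        k′ = toℕ i + (k ∸ toℕ j)
        j+ : toℕ j + (k ∸ toℕ j) ≡ k
        j+ = ℕP.m+[n∸m]≡n (ℕP.<⇒≤ (ℕP.≤-<-trans (ℕP.≤-pred (FinP.toℕ<n j)) K<k))
        k′<k : k′ < k
        k′<k = subst (k′ <_) j+ (ℕP.+-monoˡ-< (k ∸ toℕ j) i<j)

      reaches? : ∀ ρ n v → Dec (Reaches ρ n v)
      reaches? ρ n v = map′ (λ (i , p) → toℕ i , p)
        (λ (k , p) → let j , j<1+K , q = shorten n k v (<-wellFounded k) in
          fromℕ< j<1+K , trans (cong (λ z → iterate n z v) (FinP.toℕ-fromℕ< j<1+K)) (trans q p))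
        (FinP.any? {n = suc K} (λ i → iterate n (toℕ i) v ≟ ρ))

-- Exchanging the choices at a pair of twins.

-- Two vertices e and f share their two possible successors x false and x true. Under A b the vertex f goes
-- to x b and e to the other one; under B b both go to x b. For a fixed map elsewhere, equally many b
-- make A b and B b a tree.
module Twins {a} {V : Set a} (_≟_ : ∀ (v w : V) → Dec (v ≡ w)) {ρ e f : V} (e≢ρ : e ≢ ρ) (f≢ρ : f ≢ ρ)
  (x : Bool → V) (g : V → V) (A B : Bool → V → V)
  (A-e : ∀ b → A b e ≡ x (not b)) (A-f : ∀ b → A b f ≡ x b) (A-g : ∀ b v → v ≢ e → v ≢ f → A b v ≡ g v)
  (B-e : ∀ b → B b e ≡ x b) (B-f : ∀ b → B b f ≡ x b) (B-g : ∀ b v → v ≢ e → v ≢ f → B b v ≡ g v)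
  where

  -- A path along g that stops at its first visit to ρ, e or f.
  data _⟶_ : V → V → Set a where
    stop : ∀ {v} → v ⟶ v
    step : ∀ {v w} → v ≢ ρ → v ≢ e → v ≢ f → g v ⟶ w → v ⟶ w

  Agrees : (V → V) → Set a
  Agrees n = ∀ v → v ≢ e → v ≢ f → n v ≡ g v

  follow : ∀ {n v w} → Agrees n → v ⟶ w → Reaches ρ n w → Reaches ρ n v
  follow ag stop                 r = r
  follow ag (step v≢ρ v≢e v≢f p) r = reaches-step (ag _ v≢e v≢f) (follow ag p r)

  exit : ∀ {n v} → Agrees n → Reaches ρ n v → v ⟶ ρ ⊎ v ⟶ e ⊎ v ⟶ f
  exit {n} ag (k , p) = go k p
    where
    go : ∀ k {v} → iterate n k v ≡ ρ → v ⟶ ρ ⊎ v ⟶ e ⊎ v ⟶ f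
    go zero        refl = inj₁ stop
    go (suc k) {v} p with v ≟ ρ | v ≟ e | v ≟ f
    ... | yes refl | _ | _ = inj₁ stop
    ... | no _ | yes refl | _ = inj₂ (inj₁ stop)
    ... | no _ | no _ | yes refl = inj₂ (inj₂ stop)
    ... | no v≢ρ | no v≢e | no v≢f = ⊎-map prepend (⊎-map prepend prepend) (go k p)
      where
      prepend : ∀ {w} → n v ⟶ w → v ⟶ w
      prepend q = step v≢ρ v≢e v≢f (subst (_⟶ _) (ag v v≢e v≢f) q)

  -- Whereas `exit` stops at the first twin on the path, this keeps the stretch after the last one,
  -- which runs along `g` to the root.
  last-twin : ∀ {n v} → Agrees n → Reaches ρ n v → v ⟶ ρ ⊎ n e ⟶ ρ ⊎ n f ⟶ ρ
  last-twin {n} {v} ag (zero  , refl) = inj₁ stop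
  last-twin {n} {v} ag (suc k , p) with v ≟ ρ | v ≟ e | v ≟ f | last-twin {v = n v} ag (k , p)
  ... | yes refl | _ | _ | _ = inj₁ stop
  ... | _ | _ | _ | inj₂ q = inj₂ q
  ... | no _ | yes refl | _ | inj₁ q = inj₂ (inj₁ q)
  ... | no _ | no _ | yes refl | inj₁ q = inj₂ (inj₂ q)
  ... | no v≢ρ | no v≢e | no v≢f | inj₁ q = inj₁ (step v≢ρ v≢e v≢f (subst (_⟶ ρ) (ag v v≢e v≢f) q))

  twin-exit : ∀ {n} → Agrees n → IsTree ρ n → n e ⟶ ρ ⊎ n f ⟶ ρ
  twin-exit ag t with last-twin ag (t e)
  ... | inj₁ stop             = contradiction refl e≢ρ
  ... | inj₁ (step _ e≢e _ _) = contradiction refl e≢e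
  ... | inj₂ q                = q

  -- Iteration from `u` would stay for ever on the closed walk, none of whose vertices is the root.
  no-cycle : ∀ {n u} → Agrees n → IsTree ρ n → u ≢ ρ → u ≡ e ⊎ u ≡ f → ¬ (n u ⟶ u)
  no-cycle {n} {u} ag t u≢ρ tw cyc = go (proj₁ (t u)) stop (proj₂ (t u))
    where
    go : ∀ k {v} → v ⟶ u → ¬ (iterate n k v ≡ ρ)
    go zero    stop            q = u≢ρ q
    go zero    (step ne _ _ _) q = ne q
    go (suc k) stop            q = go k cyc q
    go (suc k) (step _ ne nf p) q = go k (subst (_⟶ u) (sym (ag _ ne nf)) p) q

  -- Away from the twins both maps follow `g`. A path of the tree `n`, cut at its first visit to the
  -- root or a twin, is therefore also a path of `m`.
  tree : ∀ {n m} → Agrees n → Agrees m → IsTree ρ n → Reaches ρ m e → Reaches ρ m f → IsTree ρ m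
  tree agn agm t re rf v with exit agn (t v)
  ... | inj₁ p        = follow agm p (0 , refl)
  ... | inj₂ (inj₁ p) = follow agm p re
  ... | inj₂ (inj₂ p) = follow agm p rf

  direct : ∀ {n v} → Agrees n → v ⟶ ρ → Reaches ρ n v
  direct ag p = follow ag p (0 , refl)

  to-B : ∀ b c → IsTree ρ (A b) → x c ⟶ ρ → IsTree ρ (B c)
  to-B b c t p = tree (A-g b) (B-g c) t (reaches-step (B-e c) (direct (B-g c) p)) (reaches-step (B-f c) (direct (B-g c) p))

  -- Whichever twin is visited last on the way to the root, it leaves through `x b`.
  from-B : ∀ b → IsTree ρ (B b) → x b ⟶ ρ
  from-B b t with twin-exit (B-g b) t
  ... | inj₁ p = subst (_⟶ ρ) (B-e b) p
  ... | inj₂ p = subst (_⟶ ρ) (B-f b) p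

  -- One of the twins has a successor from which `g` leads directly to the root; both twins are
  -- given that choice.
  some-A⇒B : ∀ {b} → IsTree ρ (A b) → Σ Bool λ c → IsTree ρ (B c)
  some-A⇒B {b} t with twin-exit (A-g b) t
  ... | inj₁ p = not b , to-B b (not b) t (subst (_⟶ ρ) (A-e b) p)
  ... | inj₂ p = b , to-B b b t (subst (_⟶ ρ) (A-f b) p)

  -- The twin that keeps `x b` reaches the root by `from-B`. The other one is sent to `x (not b)`,
  -- and it is chosen so that the path from there does not return to it first: that path ends at the
  -- root or at the twin that keeps `x b`.
  some-B⇒A : ∀ {b} → IsTree ρ (B b) → Σ Bool λ c → IsTree ρ (A c)
  some-B⇒A {b} t with exit (B-g b) (t (x (not b)))
  ... | inj₁ p        = b , tree (B-g b) (A-g b) t (reaches-step (A-e b) (direct (A-g b) p)) (reaches-step (A-f b) (direct (A-g b) (from-B b t)))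
  ... | inj₂ (inj₂ p) = b , tree (B-g b) (A-g b) t (reaches-step (A-e b) (follow (A-g b) p rf)) rf
    where rf = reaches-step (A-f b) (direct (A-g b) (from-B b t))
  ... | inj₂ (inj₁ p) = not b , tree (B-g b) (A-g (not b)) t re (reaches-step (A-f (not b)) (follow (A-g (not b)) p re))
    where re = reaches-step (trans (A-e (not b)) (cong x (BoolP.not-involutive b))) (direct (A-g (not b)) (from-B b t))

  -- If the path from `x b` met a twin first, then whichever of the two given trees sends that twin
  -- to `x b` would contain a cycle. So the path reaches the root directly.
  both-A⇒B : (∀ b → IsTree ρ (A b)) → ∀ b → IsTree ρ (B b)
  both-A⇒B t b with exit (A-g b) (t b (x b))
  ... | inj₁ p        = to-B b b (t b) p
  ... | inj₂ (inj₁ p) = contradiction (subst (_⟶ e) (sym (trans (A-e (not b)) (cong x (BoolP.not-involutive b)))) p) (no-cycle (A-g (not b)) (t (not b)) e≢ρ (inj₁ refl))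
  ... | inj₂ (inj₂ p) = contradiction (subst (_⟶ f) (sym (A-f b)) p) (no-cycle (A-g b) (t b) f≢ρ (inj₂ refl))

  -- By `from-B` both successors lead directly to the root, so each twin may take either.
  both-B⇒A : (∀ b → IsTree ρ (B b)) → ∀ b → IsTree ρ (A b)
  both-B⇒A t b = tree (B-g b) (A-g b) (t b)
    (reaches-step (A-e b) (direct (A-g b) (from-B (not b) (t (not b)))))
    (reaches-step (A-f b) (direct (A-g b) (from-B b (t b))))

-- Bijections obtained by changing a Boolean function at one point.

_≈₁_ : ∀ {a b} {S : Set a} {P : (S → Bool) → Set b} → Σ (S → Bool) P → Σ (S → Bool) P → Set a
x ≈₁ y = proj₁ x ≗ proj₁ y

≈₁-equiv : ∀ {a b} {S : Set a} {P : (S → Bool) → Set b} → IsEquivalence (_≈₁_ {P = P})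
≈₁-equiv = record { refl = λ _ → refl ; sym = λ p s → sym (p s) ; trans = λ p q s → trans (p s) (q s) }

same-predicate : ∀ {a b} {S : Set a} {P Q : (S → Bool) → Set b} →
  (∀ u → P u → Q u) → (∀ u → Q u → P u) → QuotBij (Σ _ P) _≈₁_ (Σ _ Q) _≈₁_
same-predicate f g = record
  { to = λ (u , p) → u , f u p ; to-cong = id ; to-inj = id ; to-surj = λ (u , q) → (u , g u q) , λ _ → refl }

module Update {a} {S : Set a} (_≟_ : ∀ (s t : S) → Dec (s ≡ t)) (s₀ : S) where

  update : (S → Bool) → Bool → S → Bool
  update u b s with s ≟ s₀
  ... | yes _ = b
  ... | no  _ = u s

  update-hit : ∀ u b → update u b s₀ ≡ b
  update-hit u b with s₀ ≟ s₀
  ... | yes _ = refl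
  ... | no ne = contradiction refl ne

  update-miss : ∀ u b {s} → s ≢ s₀ → update u b s ≡ u s
  update-miss u b {s} ne with s ≟ s₀
  ... | yes e = contradiction e ne
  ... | no  _ = refl

  update-self : ∀ u → update u (u s₀) ≗ u
  update-self u s with s ≟ s₀
  ... | yes refl = refl
  ... | no  _    = refl

  update-update : ∀ u b c → update (update u b) c ≗ update u c
  update-update u b c s with s ≟ s₀
  ... | yes _ = refl
  ... | no ne = update-miss u b ne

  update-cong : ∀ {u u′} b → u ≗ u′ → update u b ≗ update u′ b
  update-cong b p s with s ≟ s₀
  ... | yes _ = refl
  ... | no  _ = p s

  -- On each pair of functions that differ only at s₀, A and B hold equally often.
  module _ {b} {A B : (S → Bool) → Set b}
    (A-resp : ∀ {u u′} → u ≗ u′ → A u → A u′) (B-resp : ∀ {u u′} → u ≗ u′ → B u → B u′)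
    (A? : ∀ u → Dec (A u)) (B? : ∀ u → Dec (B u))
    (some-A⇒B : ∀ u {b} → A (update u b) → Σ Bool λ c → B (update u c))
    (some-B⇒A : ∀ u {b} → B (update u b) → Σ Bool λ c → A (update u c))
    (both-A⇒B : ∀ u → (∀ b → A (update u b)) → ∀ b → B (update u b))
    (both-B⇒A : ∀ u → (∀ b → B (update u b)) → ∀ b → A (update u b))
    where

    private
      flip : (S → Bool) → S → Bool
      flip u = update u (not (u s₀))

      flip-cong : ∀ {u u′} → u ≗ u′ → flip u ≗ flip u′
      flip-cong {u} {u′} p s = trans (update-cong (not (u s₀)) p s) (cong (λ b → update u′ (not b) s) (p s₀))

      flip-involutive : ∀ u → flip (flip u) ≗ u
      flip-involutive u s = trans (cong (λ b → update (flip u) (not b) s) (update-hit u _))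
        (trans (update-update u _ _ s) (trans (cong (λ b → update u b s) (BoolP.not-involutive (u s₀))) (update-self u s)))

      either : ∀ (P : (S → Bool) → Set b) → (∀ {u u′} → u ≗ u′ → P u → P u′) →
        ∀ u c → P (update u c) → P u ⊎ P (flip u)
      either P resp u c p with c BoolP.≟ u s₀
      ... | yes refl = inj₁ (resp (update-self u) p)
      ... | no  ne   = inj₂ (subst (λ z → P (update u z)) (BoolP.¬-not ne) p)

      both : ∀ (P : (S → Bool) → Set b) → (∀ {u u′} → u ≗ u′ → P u → P u′) →
        ∀ {u} → P u → P (flip u) → ∀ c → P (update u c)
      both P resp {u} p q c with c BoolP.≟ u s₀
      ... | yes refl = resp (sym ∘ update-self u) p
      ... | no  ne   = subst (λ z → P (update u z)) (sym (BoolP.¬-not ne)) q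

      A⇒B : ∀ u → A u → ¬ B u → B (flip u)
      A⇒B u p ¬q with some-A⇒B u (A-resp (sym ∘ update-self u) p)
      ... | c , r with either B B-resp u c r
      ...   | inj₁ q = contradiction q ¬q
      ...   | inj₂ q = q

      B⇒A : ∀ u → B u → ¬ A u → A (flip u)
      B⇒A u p ¬q with some-B⇒A u (B-resp (sym ∘ update-self u) p)
      ... | c , r with either A A-resp u c r
      ...   | inj₁ q = contradiction q ¬q
      ...   | inj₂ q = q

      pair-B : ∀ u → A u → A (flip u) → B u
      pair-B u p q = B-resp (update-self u) (both-A⇒B u (both A A-resp p q) (u s₀))

      pair-A : ∀ u → B u → B (flip u) → A u
      pair-A u p q = A-resp (update-self u) (both-B⇒A u (both B B-resp p q) (u s₀))

      -- A function is moved only within its pair, and only if `B` fails at it. If both members of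
      -- the pair satisfy `A`, both satisfy `B`, so neither is moved and they cannot collide.
      to′ : Σ _ A → Σ _ B
      to′ (u , p) with B? u
      ... | yes q = u , q
      ... | no ¬q = flip u , A⇒B u p ¬q

      to′-cong : ∀ x y → x ≈₁ y → to′ x ≈₁ to′ y
      to′-cong (u , p) (u′ , p′) e with B? u | B? u′
      ... | yes q | yes q′ = e
      ... | no ¬q | no ¬q′ = flip-cong e
      ... | yes q | no ¬q′ = contradiction (B-resp e q) ¬q′
      ... | no ¬q | yes q′ = contradiction (B-resp (sym ∘ e) q′) ¬q

      to′-inj : ∀ x y → to′ x ≈₁ to′ y → x ≈₁ y
      to′-inj (u , p) (u′ , p′) e with B? u | B? u′
      ... | yes q | yes q′ = e
      ... | no ¬q | no ¬q′ = λ s → trans (sym (flip-involutive u s)) (trans (flip-cong e s) (flip-involutive u′ s))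
      ... | yes q | no ¬q′ = contradiction (pair-B u′ p′ (A-resp e p)) ¬q′
      ... | no ¬q | yes q′ = contradiction (pair-B u p (A-resp (sym ∘ e) p′)) ¬q

      to′-surj : ∀ z → Σ _ λ x → to′ x ≈₁ z
      to′-surj (z , q) with A? z
      ... | yes p = (z , p) , fixed
        where
        fixed : to′ (z , p) ≈₁ (z , q)
        fixed with B? z
        ... | yes _ = λ _ → refl
        ... | no ¬q = contradiction q ¬q
      ... | no ¬p = (flip z , p′) , flipped
        where
        p′ = B⇒A z q ¬p
        flipped : to′ (flip z , p′) ≈₁ (z , q)
        flipped with B? (flip z)
        ... | yes q′ = contradiction (pair-A z q q′) ¬p
        ... | no _   = flip-involutive z

    update-bijection : QuotBij (Σ _ A) _≈₁_ (Σ _ B) _≈₁_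
    update-bijection = record
      { to = to′ ; to-cong = λ {x} {y} → to′-cong x y ; to-inj = λ {x} {y} → to′-inj x y ; to-surj = to′-surj }

-- Trees in the de Bruijn graph and patterns of agreement between twins.

Vertex : ℕ → Set
Vertex = Vec Bool

root : ∀ d → Vertex d
root d = replicate d false

_≟ᵛ_ : ∀ {d} (v w : Vertex d) → Dec (v ≡ w)
_≟ᵛ_ = VecP.≡-dec BoolP._≟_

-- The bit `t v` selects one of the two edges of the de Bruijn graph that leave `v`.
step : ∀ {d} → (Vertex d → Bool) → Vertex d → Vertex d
step t v = tail (v ∷ʳ t v)

step-cong : ∀ {d} {t t′ : Vertex d → Bool} → t ≗ t′ → step t ≗ step t′
step-cong p v = cong (λ b → tail (v ∷ʳ b)) (p v)

Tree : ∀ {d} → (Vertex d → Bool) → Set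
Tree {d} t = IsTree (root d) (step t)

Tree-cong : ∀ {d} {t t′ : Vertex d → Bool} → t ≗ t′ → Tree t → Tree t′
Tree-cong p = IsTree-cong (step-cong p)

code : ∀ {d} → Vertex d → Fin (2 ^ d)
code {d} v = QuotBij.to (Word-enumerated d) (lookup v)

code-injective : ∀ {d} {v w : Vertex d} → code v ≡ code w → v ≡ w
code-injective {d} {v} {w} p = trans (sym (VecP.tabulate∘lookup v))
  (trans (VecP.tabulate-cong (QuotBij.to-inj (Word-enumerated d) p)) (VecP.tabulate∘lookup w))

decode : ∀ d → Fin (2 ^ d) → Vertex d
decode d i = tabulate (proj₁ (QuotBij.to-surj (Word-enumerated d) i))

code-decode : ∀ d (i : Fin (2 ^ d)) → code (decode d i) ≡ i
code-decode d i = trans (QuotBij.to-cong (Word-enumerated d) (VecP.lookup∘tabulate w)) (proj₂ (QuotBij.to-surj (Word-enumerated d) i))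
  where w = proj₁ (QuotBij.to-surj (Word-enumerated d) i)

∀ᵛ? : ∀ {d p} {P : Vertex d → Set p} → (∀ v → Dec (P v)) → Dec (∀ v → P v)
∀ᵛ? {zero}  P? = map′ (λ p → λ { [] → p }) (λ p → p []) (P? [])
∀ᵛ? {suc d} P? = map′ (λ (p , q) → λ { (false ∷ v) → p v ; (true ∷ v) → q v })
  (λ p → (λ v → p (false ∷ v)) , (λ v → p (true ∷ v)))
  (∀ᵛ? (λ v → P? (false ∷ v)) ×-dec ∀ᵛ? (λ v → P? (true ∷ v)))

Tree? : ∀ {d} (t : Vertex d → Bool) → Dec (Tree t)
Tree? {d} t = ∀ᵛ? (λ v → reaches? _≟ᵛ_ code code-injective (root d) (step t) v)

root-∷ʳ : ∀ d → root d ∷ʳ false ≡ root (suc d)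
root-∷ʳ zero    = refl
root-∷ʳ (suc d) = cong (false ∷_) (root-∷ʳ d)

-- The last vertex before the root is a predecessor of the root other than the root itself, which
-- leaves only `true ∷ root d`; its edge must append 0.
root-exit : ∀ {d} (t : Vertex (suc d) → Bool) → Tree t → t (true ∷ root d) ≡ false
root-exit {d} t tree with last-step _≟ᵛ_ {v = true ∷ root d} (λ ()) (tree (true ∷ root d))
... | c ∷ s , v≢ρ , p with VecP.∷ʳ-injective s (root d) (trans p (sym (root-∷ʳ d)))
...   | refl , q with c
...     | true  = q
...     | false = contradiction refl v≢ρ

-- The successors of 0s and 1s in terms of u s, the choice at 1s, and of q s, which tells whether 0s chooses differently.
twin : ∀ {d} → (Vertex d → Bool) → (Vertex d → Bool) → Vertex (suc d) → Bool
twin q u (b ∷ s) = (not b ∧ q s) xor u s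

twin-congˡ : ∀ {d} {q q′ : Vertex d → Bool} u → q ≗ q′ → twin q u ≗ twin q′ u
twin-congˡ u p (b ∷ s) = cong (λ c → (not b ∧ c) xor u s) (p s)

twin-congʳ : ∀ {d} q {u u′ : Vertex d → Bool} → u ≗ u′ → twin q u ≗ twin q u′
twin-congʳ q p (b ∷ s) = cong ((not b ∧ q s) xor_) (p s)

TwinTree : ∀ {d} → (Vertex d → Bool) → Set
TwinTree q = Σ (_ → Bool) λ u → Tree (twin q u)

TwinTree-cong : ∀ {d} {q q′ : Vertex d → Bool} → q ≗ q′ → QuotBij (TwinTree q) _≈₁_ (TwinTree q′) _≈₁_
TwinTree-cong p = same-predicate (λ u → Tree-cong (twin-congˡ u p)) (λ u → Tree-cong (twin-congˡ u (sym ∘ p)))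

module _ {d} (s₀ : Vertex d) where
  open Update _≟ᵛ_ s₀

  clear : (Vertex d → Bool) → Vertex d → Bool
  clear q = update q false

  -- The only edge that changes is the one leaving the root, so `IsTree-offRoot` applies.
  TwinTree-clear-root : ∀ q → s₀ ≡ root d → QuotBij (TwinTree q) _≈₁_ (TwinTree (clear q)) _≈₁_
  TwinTree-clear-root q s₀≡ρ = same-predicate
    (λ u → IsTree-offRoot _≟ᵛ_ (λ v v≢ρ → step-cong′ u v v≢ρ))
    (λ u → IsTree-offRoot _≟ᵛ_ (λ v v≢ρ → sym (step-cong′ u v v≢ρ)))
    where
    step-cong′ : ∀ u v → v ≢ root (suc d) → step (twin q u) v ≡ step (twin (clear q) u) v
    step-cong′ u (true  ∷ s) _   = refl
    step-cong′ u (false ∷ s) v≢ρ = cong (λ b → s ∷ʳ (b xor u s))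
      (sym (update-miss q false (λ e → v≢ρ (cong (false ∷_) (trans e s₀≡ρ)))))

  -- At `s₀` the pattern `q` asks the twins to differ and `clear q` asks them to agree. These are
  -- the situations `A` and `B` of `Twins`, and its four implications are what `update-bijection`
  -- takes as input.
  TwinTree-clear-true : ∀ q → s₀ ≢ root d → q s₀ ≡ true → QuotBij (TwinTree q) _≈₁_ (TwinTree (clear q)) _≈₁_
  TwinTree-clear-true q s₀≢ρ qs₀ = update-bijection
    (λ p → Tree-cong (twin-congʳ q p)) (λ p → Tree-cong (twin-congʳ (clear q) p))
    (λ u → Tree? (twin q u)) (λ u → Tree? (twin (clear q) u))
    (λ u {b} → T.some-A⇒B u {b}) (λ u {b} → T.some-B⇒A u {b}) T.both-A⇒B T.both-B⇒A
    where
    e f : Vertex (suc d)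
    e = false ∷ s₀
    f = true ∷ s₀
    off-twins : ∀ (q u : Vertex d → Bool) b v → v ≢ e → v ≢ f →
      step (twin q (update u b)) v ≡ step (twin q u) v
    off-twins q u b (false ∷ s) v≢e v≢f = cong (λ c → s ∷ʳ (q s xor c)) (update-miss u b (λ p → v≢e (cong (false ∷_) p)))
    off-twins q u b (true  ∷ s) v≢e v≢f = cong (s ∷ʳ_) (update-miss u b (λ p → v≢f (cong (true ∷_) p)))
    off-clear : ∀ u v → v ≢ e → v ≢ f → step (twin (clear q) u) v ≡ step (twin q u) v
    off-clear u (false ∷ s) v≢e v≢f = cong (λ c → s ∷ʳ (c xor u s)) (update-miss q false (λ p → v≢e (cong (false ∷_) p)))
    off-clear u (true  ∷ s) v≢e v≢f = refl
    e≢ρ : e ≢ root (suc d)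
    e≢ρ refl = s₀≢ρ refl
    f≢ρ : f ≢ root (suc d)
    f≢ρ ()
    at-e : ∀ u b → s₀ ∷ʳ (q s₀ xor update u b s₀) ≡ s₀ ∷ʳ not b
    at-e u b = cong₂ (λ c c′ → s₀ ∷ʳ (c xor c′)) qs₀ (update-hit u b)
    at-e-clear : ∀ u b → s₀ ∷ʳ (clear q s₀ xor update u b s₀) ≡ s₀ ∷ʳ b
    at-e-clear u b = cong₂ (λ c c′ → s₀ ∷ʳ (c xor c′)) (update-hit q false) (update-hit u b)
    at-f : ∀ u b → s₀ ∷ʳ update u b s₀ ≡ s₀ ∷ʳ b
    at-f u b = cong (s₀ ∷ʳ_) (update-hit u b)
    off-twins-clear : ∀ u b v → v ≢ e → v ≢ f → step (twin (clear q) (update u b)) v ≡ step (twin q u) v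
    off-twins-clear u b v v≢e v≢f = trans (off-twins (clear q) u b v v≢e v≢f) (off-clear u v v≢e v≢f)
    module T (u : Vertex d → Bool) = Twins _≟ᵛ_ {root (suc d)} {e} {f} e≢ρ f≢ρ
      (s₀ ∷ʳ_) (step (twin q u)) (λ b → step (twin q (update u b))) (λ b → step (twin (clear q) (update u b)))
      (at-e u) (at-f u) (off-twins q u) (at-e-clear u) (at-f u) (off-twins-clear u)

  TwinTree-clear : ∀ q → QuotBij (TwinTree q) _≈₁_ (TwinTree (clear q)) _≈₁_
  TwinTree-clear q with s₀ ≟ᵛ root d
  ... | yes s₀≡ρ = TwinTree-clear-root q s₀≡ρ
  ... | no  s₀≢ρ with q s₀ in qs₀
  ...   | true  = TwinTree-clear-true q s₀≢ρ qs₀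
  ...   | false = TwinTree-cong (λ s → trans (sym (update-self q s)) (cong (λ b → update q b s) qs₀))

vertices : ∀ d → List (Vertex d)
vertices zero    = [] ∷ []
vertices (suc d) = map (false ∷_) (vertices d) ++ map (true ∷_) (vertices d)

∈-vertices : ∀ {d} (v : Vertex d) → v ∈ vertices d
∈-vertices []          = here refl
∈-vertices (false ∷ v) = Mem.∈-++⁺ˡ (Mem.∈-map⁺ (false ∷_) (∈-vertices v))
∈-vertices (true  ∷ v) = Mem.∈-++⁺ʳ (map (false ∷_) (vertices _)) (Mem.∈-map⁺ (true ∷_) (∈-vertices v))

clearAll : ∀ {d} → List (Vertex d) → (Vertex d → Bool) → Vertex d → Bool
clearAll []       q = q
clearAll (s ∷ ss) q = clear s (clearAll ss q)

clearAll-∈ : ∀ {d} {ss : List (Vertex d)} q {s} → s ∈ ss → clearAll ss q s ≡ false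
clearAll-∈ {ss = s′ ∷ ss} q (here refl) = Update.update-hit _≟ᵛ_ s′ (clearAll ss q) false
clearAll-∈ {ss = s′ ∷ ss} q {s} (there s∈) with s ≟ᵛ s′
... | yes _ = refl
... | no  _ = clearAll-∈ q s∈

TwinTree-clearAll : ∀ {d} (ss : List (Vertex d)) q → QuotBij (TwinTree q) _≈₁_ (TwinTree (clearAll ss q)) _≈₁_
TwinTree-clearAll []       q = same-predicate (λ _ → id) (λ _ → id)
TwinTree-clearAll (s ∷ ss) q = QuotBij-trans ≈₁-equiv (TwinTree-clearAll ss q) (TwinTree-clear s (clearAll ss q))

-- A tree prescribes no edge at its root; fixing the bit there to false makes the labelling unique.
RootedTree : ℕ → Set
RootedTree d = Σ (Vertex d → Bool) λ t → t (root d) ≡ false × Tree t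

-- If both twins 0s and 1s behave alike, they may be identified, which leaves a tree on words one letter shorter.
TwinTree-collapse : ∀ {d} → QuotBij (TwinTree {d} (λ _ → false)) _≈₁_ (RootedTree d) _≈₁_
TwinTree-collapse {d} = same-predicate
  (λ u tree → root-exit (twin (λ _ → false) u) tree , λ s →
    let k , p = tree (false ∷ s) in k , trans (sym (tail-iterate u k (false ∷ s))) (cong tail p))
  (λ u (uρ , tree) v → let k , p = tree (tail v) in lift u uρ k v (trans (tail-iterate u k v) p))
  where
  stepᵗ : (Vertex d → Bool) → Vertex (suc d) → Vertex (suc d)
  stepᵗ u = step (twin (λ _ → false) u)
  twin-false : ∀ u v → stepᵗ u v ≡ tail v ∷ʳ u (tail v)
  twin-false u (false ∷ s) = refl
  twin-false u (true  ∷ s) = refl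
  tail-iterate : ∀ u k v → tail (iterate (stepᵗ u) k v) ≡ iterate (step u) k (tail v)
  tail-iterate u zero    v = refl
  tail-iterate u (suc k) v = trans (tail-iterate u k (stepᵗ u v)) (cong (iterate (step u) k ∘ tail) (twin-false u v))
  lift : ∀ u → u (root d) ≡ false → ∀ k v → tail (iterate (stepᵗ u) k v) ≡ root d →
    Reaches (root (suc d)) (stepᵗ u) v
  -- After `k` steps only the first letter can still be wrong. One further step drops it and appends
  -- `u (root d)`, which is 0.
  lift u uρ k v p = k + 1 , trans (iterate-+ (stepᵗ u) k 1 v)
    (trans (twin-false u (iterate (stepᵗ u) k v)) (trans (cong (λ s → s ∷ʳ u s) p)
    (trans (cong (root d ∷ʳ_) uρ) (root-∷ʳ d))))

-- Used twice: for every pattern `q` in the recursion that counts trees, and for the constant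
-- pattern true, which gives the Hamiltonian cycles.
TwinTree≃RootedTree : ∀ {d} q → QuotBij (TwinTree q) _≈₁_ (RootedTree d) _≈₁_
TwinTree≃RootedTree {d} q = QuotBij-trans ≈₁-equiv (TwinTree-clearAll (vertices d) q)
  (QuotBij-trans ≈₁-equiv (TwinTree-cong (λ s → clearAll-∈ q (∈-vertices s))) TwinTree-collapse)

-- Counting labellings and rooted trees.

_×≈_ : ∀ {a b r s} {A : Set a} {B : Set b} → (A → A → Set r) → (B → B → Set s) → A × B → A × B → Set _
(R ×≈ S) (x , y) (x′ , y′) = R x x′ × S y y′

×-enumerated : ∀ {a b r s} {A : Set a} {_~_ : A → A → Set r} {B : Set b} {_≈_ : B → B → Set s} {m n} →
  Enumerated A _~_ m → Enumerated B _≈_ n → Enumerated (A × B) (_~_ ×≈ _≈_) (m * n)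
×-enumerated {m = m} {n} P Q = record
  { to      = λ (x , y) → combine (P.to x) (Q.to y)
  ; to-cong = λ (p , q) → cong₂ combine (P.to-cong p) (Q.to-cong q)
  ; to-inj  = λ {x} {y} p → let e , e′ = FinP.combine-injective (P.to (proj₁ x)) _ (P.to (proj₁ y)) _ p
                            in P.to-inj e , Q.to-inj e′
  ; to-surj = λ z → let i , j = remQuot {m} n z ; x , p = P.to-surj i ; y , q = Q.to-surj j
                    in (x , y) , trans (cong₂ combine p q) (FinP.combine-remQuot {m} n z)
  }
  where
  module P = QuotBij P
  module Q = QuotBij Q

-- In closed form these are 2^n, 2^(n-1) and 2^(n-d-1) with n = 2^d. The recursions mirror the
-- decompositions by which the sets are enumerated, and they avoid subtraction.
#labellings #zeroed #trees : ℕ → ℕ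
#labellings zero    = 2
#labellings (suc d) = #labellings d * #labellings d
#zeroed zero    = 1
#zeroed (suc d) = #zeroed d * #labellings d
#trees zero    = 1
#trees (suc d) = #zeroed d * #trees d

#zeroed-2 : ∀ d → #zeroed d * 2 ≡ #labellings d
#zeroed-2 zero    = refl
#zeroed-2 (suc d) = begin
  #zeroed d * #labellings d * 2   ≡⟨ ℕP.*-assoc (#zeroed d) _ 2 ⟩
  #zeroed d * (#labellings d * 2) ≡⟨ cong (#zeroed d *_) (ℕP.*-comm (#labellings d) 2) ⟩
  #zeroed d * (2 * #labellings d) ≡⟨ ℕP.*-assoc (#zeroed d) 2 _ ⟨
  #zeroed d * 2 * #labellings d   ≡⟨ cong (_* #labellings d) (#zeroed-2 d) ⟩
  #labellings d * #labellings d   ∎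
  where open ≡-Reasoning

#labellings≡ : ∀ d → #labellings d ≡ 2 ^ (2 ^ d)
#labellings≡ zero    = refl
#labellings≡ (suc d) = trans (cong₂ _*_ (#labellings≡ d) (#labellings≡ d))
  (trans (sym (ℕP.^-distribˡ-+-* 2 (2 ^ d) (2 ^ d))) (cong (λ n → 2 ^ (2 ^ d + n)) (sym (ℕP.+-identityʳ (2 ^ d)))))

-- This is the equation satisfied by the number of odd necklaces: `#zeroed d` odd words in orbits of
-- size 2^d.
#trees-2^ : ∀ d → #trees d * 2 ^ d ≡ #zeroed d
#trees-2^ zero    = refl
#trees-2^ (suc d) = begin
  #zeroed d * #trees d * (2 * 2 ^ d)   ≡⟨ cong (#zeroed d * #trees d *_) (ℕP.*-comm 2 (2 ^ d)) ⟩
  #zeroed d * #trees d * (2 ^ d * 2)   ≡⟨ ℕP.*-assoc (#zeroed d * #trees d) _ 2 ⟨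
  #zeroed d * #trees d * 2 ^ d * 2     ≡⟨ cong (_* 2) (ℕP.*-assoc (#zeroed d) _ _) ⟩
  #zeroed d * (#trees d * 2 ^ d) * 2   ≡⟨ cong (λ n → #zeroed d * n * 2) (#trees-2^ d) ⟩
  #zeroed d * #zeroed d * 2            ≡⟨ ℕP.*-assoc (#zeroed d) _ 2 ⟩
  #zeroed d * (#zeroed d * 2)          ≡⟨ cong (#zeroed d *_) (#zeroed-2 d) ⟩
  #zeroed d * #labellings d            ∎
  where open ≡-Reasoning

labellings-enumerated : ∀ d → Enumerated (Vertex d → Bool) _≗_ (#labellings d)
labellings-enumerated zero = QuotBij-trans ≡-equiv (record
  { to = λ t _ → t [] ; to-cong = λ p _ → p [] ; to-inj = λ { p [] → p zero } ; to-surj = λ z → (λ _ → z zero) , λ { zero → refl } })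
  (Word-enumerated 1)
labellings-enumerated (suc d) = QuotBij-trans ≡-equiv (record
  { to = λ t → (λ s → t (false ∷ s)) , (λ s → t (true ∷ s))
  ; to-cong = λ p → (λ s → p (false ∷ s)) , (λ s → p (true ∷ s))
  ; to-inj = λ { (p , q) (false ∷ s) → p s ; (p , q) (true ∷ s) → q s }
  ; to-surj = λ (t , t′) → (λ { (false ∷ s) → t s ; (true ∷ s) → t′ s }) , (λ _ → refl) , (λ _ → refl) })
  (×-enumerated (labellings-enumerated d) (labellings-enumerated d))

-- These serve as the patterns of disagreement of rooted trees. The root chooses 0 by convention and
-- its twin by `root-exit`, so the pattern is false at the root.
Zeroed : ℕ → Set
Zeroed d = Σ (Vertex d → Bool) λ t → t (root d) ≡ false

zeroed-enumerated : ∀ d → Enumerated (Zeroed d) _≈₁_ (#zeroed d)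
zeroed-enumerated zero = record
  { to = λ _ → zero ; to-cong = λ _ → refl
  ; to-inj = λ { {_ , p} {_ , q} _ [] → trans p (sym q) } ; to-surj = λ { zero → ((λ _ → false) , refl) , refl } }
zeroed-enumerated (suc d) = QuotBij-trans ≡-equiv (record
  { to = λ (t , p) → ((λ s → t (false ∷ s)) , p) , (λ s → t (true ∷ s))
  ; to-cong = λ p → (λ s → p (false ∷ s)) , (λ s → p (true ∷ s))
  ; to-inj = λ { (p , q) (false ∷ s) → p s ; (p , q) (true ∷ s) → q s }
  ; to-surj = λ ((t , p) , t′) → ((λ { (false ∷ s) → t s ; (true ∷ s) → t′ s }) , p) , (λ _ → refl) , (λ _ → refl) })
  (×-enumerated (zeroed-enumerated d) (labellings-enumerated d))

xor-cancelʳ : ∀ a b → (a xor b) xor b ≡ a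
xor-cancelʳ a b = trans (BoolP.xor-assoc a b b) (trans (cong (a xor_) (BoolP.xor-same b)) (BoolP.xor-identityʳ a))

-- A tree is encoded by its pattern of disagreement and by its choices at the vertices 1s. The fibre
-- over each pattern consists of twin trees, which are as numerous as the rooted trees on words one
-- letter shorter.
RootedTree-enumerated : ∀ d → Enumerated (RootedTree d) _≈₁_ (#trees d)
RootedTree-enumerated zero = record
  { to = λ _ → zero ; to-cong = λ _ → refl
  ; to-inj = λ { {_ , p , _} {_ , q , _} _ [] → trans p (sym q) }
  ; to-surj = λ { zero → ((λ _ → false) , refl , λ { [] → 0 , refl }) , refl } }
RootedTree-enumerated (suc d) = record
  { to      = λ x → combine (index x) (fibre x)
  ; to-cong = λ {x} {y} p → cong₂ combine (index-cong x y p) (value-cong (twinTree x) (twinTree y) (index-cong x y p) (λ s → p (true ∷ s)))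
  ; to-inj  = λ {x} {y} p → let i , j = FinP.combine-injective (index x) _ (index y) _ p in inj x y i j
  ; to-surj = surj
  }
  where
  module Q = QuotBij (zeroed-enumerated d)
  el : Fin (#zeroed d) → Vertex d → Bool
  el i = proj₁ (proj₁ (Q.to-surj i))
  twinTrees : ∀ i → Enumerated (TwinTree (el i)) _≈₁_ (#trees d)
  twinTrees i = QuotBij-trans ≡-equiv (TwinTree≃RootedTree (el i)) (RootedTree-enumerated d)
  module F (i : Fin (#zeroed d)) = QuotBij (twinTrees i)
  diff : RootedTree (suc d) → Zeroed d
  diff (t , tρ , tree) = (λ s → t (false ∷ s) xor t (true ∷ s)) , cong₂ _xor_ tρ (root-exit t tree)
  index : RootedTree (suc d) → Fin (#zeroed d)
  index x = Q.to (diff x)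
  el-index : ∀ x → el (index x) ≗ proj₁ (diff x)
  el-index x = Q.to-inj (proj₂ (Q.to-surj (index x)))
  twin-diff : ∀ x → twin (proj₁ (diff x)) (λ s → proj₁ x (true ∷ s)) ≗ proj₁ x
  twin-diff x (false ∷ s) = xor-cancelʳ _ (proj₁ x (true ∷ s))
  twin-diff x (true  ∷ s) = refl
  -- The enumeration returns the pattern of `x` only up to pointwise equality, so the tree property
  -- has to be transported.
  twin-index : ∀ x → twin (el (index x)) (λ s → proj₁ x (true ∷ s)) ≗ proj₁ x
  twin-index x v = trans (twin-congˡ _ (el-index x) v) (twin-diff x v)
  twinTree : ∀ x → TwinTree (el (index x))
  twinTree x = (λ s → proj₁ x (true ∷ s)) , Tree-cong (sym ∘ twin-index x) (proj₂ (proj₂ x))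
  fibre : RootedTree (suc d) → Fin (#trees d)
  fibre x = F.to (index x) (twinTree x)
  index-cong : ∀ x y → x ≈₁ y → index x ≡ index y
  index-cong x y p = Q.to-cong (λ s → cong₂ _xor_ (p (false ∷ s)) (p (true ∷ s)))
  value-cong : ∀ {i j} (u : TwinTree (el i)) (u′ : TwinTree (el j)) → i ≡ j → proj₁ u ≗ proj₁ u′ → F.to i u ≡ F.to j u′
  value-cong {i} u u′ refl p = F.to-cong i p
  value-inj : ∀ {i j} (u : TwinTree (el i)) (u′ : TwinTree (el j)) → i ≡ j → F.to i u ≡ F.to j u′ → proj₁ u ≗ proj₁ u′
  value-inj {i} u u′ refl p = F.to-inj i p
  inj : ∀ x y → index x ≡ index y → fibre x ≡ fibre y → x ≈₁ y
  inj x y p q v = trans (sym (twin-index x v)) (trans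
    (trans (cong (λ i → twin (el i) _ v) p) (twin-congʳ (el (index y)) (value-inj (twinTree x) (twinTree y) p q) v))
    (twin-index y v))
  surj : ∀ z → Σ (RootedTree (suc d)) λ x → combine (index x) (fibre x) ≡ z
  surj z = x , trans (cong₂ combine index-x (trans (value-cong (twinTree x) (u , tree) index-x (λ _ → refl)) (proj₂ (F.to-surj i c))))
                 (FinP.combine-remQuot {#zeroed d} (#trees d) z)
    where
    i = proj₁ (remQuot {#zeroed d} (#trees d) z)
    c = proj₂ (remQuot {#zeroed d} (#trees d) z)
    u = proj₁ (proj₁ (F.to-surj i c))
    tree : Tree (twin (el i) u)
    tree = proj₂ (proj₁ (F.to-surj i c))
    x : RootedTree (suc d)
    x = twin (el i) u , cong₂ _xor_ (proj₂ (proj₁ (Q.to-surj i))) (root-exit (twin (el i) u) tree) , tree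
    index-x : index x ≡ i
    index-x = trans (Q.to-cong (λ s → xor-cancelʳ (el i s) (u s))) (proj₂ (Q.to-surj i))

-- An injective map whose paths all reach one point is a single cycle.

module Cyclic {a} {V : Set a} {M} .{{_ : NonZero M}} (code : V → Fin M) (decode : Fin M → V)
  (code-injective : ∀ {v w} → code v ≡ code w → v ≡ w) (code-decode : ∀ i → code (decode i) ≡ i)
  {ρ : V} (n : V → V) (n-injective : ∀ {v w} → n v ≡ n w → v ≡ w) (tree : IsTree ρ n) where

  iterate-injective : ∀ k {v w} → iterate n k v ≡ iterate n k w → v ≡ w
  iterate-injective zero    p = p
  iterate-injective (suc k) p = n-injective (iterate-injective k p)

  iterate-* : ∀ k p → iterate n p ρ ≡ ρ → iterate n (k * p) ρ ≡ ρ
  iterate-* zero    p e = refl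
  iterate-* (suc k) p e = trans (iterate-+ n p (k * p) ρ) (trans (cong (iterate n (k * p)) e) (iterate-* k p e))

  iterate-% : ∀ k p .{{_ : NonZero p}} → iterate n p ρ ≡ ρ → iterate n (k % p) ρ ≡ iterate n k ρ
  iterate-% k p e = sym (begin
    iterate n k ρ                                   ≡⟨ cong (λ z → iterate n z ρ) (trans (DM.m≡m%n+[m/n]*n k p) (ℕP.+-comm (k % p) _)) ⟩
    iterate n (k / p * p + k % p) ρ                 ≡⟨ iterate-+ n (k / p * p) (k % p) ρ ⟩
    iterate n (k % p) (iterate n (k / p * p) ρ)     ≡⟨ cong (iterate n (k % p)) (iterate-* (k / p) p e) ⟩
    iterate n (k % p) ρ                             ∎)
    where open ≡-Reasoning

  -- If `ρ` returns after `p` steps and `v` reaches `ρ` in `k` steps, then -k modulo p steps from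
  -- `ρ` lead to `v`. Hence the `M` points have distinct offsets below `p`.
  period≥M : ∀ p → 0 < p → iterate n p ρ ≡ ρ → M ≤ p
  period≥M p@(suc _) _ e = FinP.injective⇒≤ {f = λ i → offset (decode i)} (λ {i} {j} q →
    trans (sym (code-decode i)) (trans (cong code (trans (sym (offset-correct (decode i)))
      (trans (cong (λ z → iterate n (toℕ z) ρ) q) (offset-correct (decode j))))) (code-decode j)))
    where
    offset : V → Fin p
    offset v = neg p (proj₁ (tree v)) mod p
    offset-correct : ∀ v → iterate n (toℕ (offset v)) ρ ≡ v
    offset-correct v = iterate-injective k (begin
      iterate n k (iterate n (toℕ (offset v)) ρ) ≡⟨ iterate-+ n (toℕ (offset v)) k ρ ⟨
      iterate n (toℕ (offset v) + k) ρ           ≡⟨ iterate-% (toℕ (offset v) + k) p e ⟨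
      iterate n ((toℕ (offset v) + k) % p) ρ     ≡⟨ cong (λ z → iterate n z ρ) (trans (cong (λ z → (z + k) % p) (toℕ-mod (neg p k) p)) (trans (%-+ˡ (neg p k) k p) (neg-+ p k))) ⟩
      ρ                                          ≡⟨ proj₂ (tree v) ⟨
      iterate n k v                              ∎)
      where
      open ≡-Reasoning
      k = proj₁ (tree v)

  repeat⇒period : ∀ {i j} → i ≤ j → iterate n i ρ ≡ iterate n j ρ → iterate n (j ∸ i) ρ ≡ ρ
  repeat⇒period {i} {j} i≤j e = sym (iterate-injective i (trans e
    (trans (cong (λ z → iterate n z ρ) (sym (ℕP.m∸n+n≡m i≤j))) (iterate-+ n (j ∸ i) i ρ))))

  orbit : Fin M → V
  orbit i = iterate n (toℕ i) ρ

  no-repeat : ∀ (i j : Fin M) → toℕ i < toℕ j → orbit i ≢ orbit j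
  no-repeat i j i<j e = ℕP.<⇒≱ (ℕP.≤-<-trans (ℕP.m∸n≤m (toℕ j) (toℕ i)) (FinP.toℕ<n j))
    (period≥M (toℕ j ∸ toℕ i) (ℕP.m<n⇒0<n∸m i<j) (repeat⇒period (ℕP.<⇒≤ i<j) e))

  orbit-injective : ∀ {i j} → orbit i ≡ orbit j → i ≡ j
  orbit-injective {i} {j} e with ℕP.<-cmp (toℕ i) (toℕ j)
  ... | tri≈ _ q _   = FinP.toℕ-injective q
  ... | tri< i<j _ _ = contradiction e (no-repeat i j i<j)
  ... | tri> _ _ j<i = contradiction (sym e) (no-repeat j i j<i)

  orbit-surjective : ∀ v → Σ (Fin M) λ i → orbit i ≡ v
  orbit-surjective v = let i , p = Fin-injective⇒surjective {f = code ∘ orbit} (orbit-injective ∘ code-injective) (code v)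
                       in i , code-injective p

  -- The point after `M` steps occurs already at some `i` below `M`, so `M ∸ i` is a period; by
  -- `period≥M` it is at least `M`, which forces `i` to be 0.
  orbit-closes : iterate n M ρ ≡ ρ
  orbit-closes = let i , p = orbit-surjective (iterate n M ρ)
                     q = repeat⇒period (ℕP.<⇒≤ (FinP.toℕ<n i)) p
                     M≤ = period≥M (M ∸ toℕ i) (ℕP.m<n⇒0<n∸m (FinP.toℕ<n i)) q
                 in subst (λ z → iterate n z ρ ≡ ρ) (ℕP.≤-antisym (ℕP.m∸n≤m M (toℕ i)) M≤) q

-- De Bruijn words as Hamiltonian cycles.

window : ∀ m → (ℕ → Bool) → Vec Bool m
window m f = tabulate (λ j → f (toℕ j))

window-cong : ∀ m {f g} → f ≗ g → window m f ≡ window m g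
window-cong m p = VecP.tabulate-cong (λ j → p (toℕ j))

window-∷ʳ : ∀ m f → window m f ∷ʳ f m ≡ window (suc m) f
window-∷ʳ zero    f = refl
window-∷ʳ (suc m) f = cong (f 0 ∷_) (window-∷ʳ m (f ∘ suc))

lookup-∷ʳ-inject₁ : ∀ {m} (v : Vec Bool m) c i → lookup (v ∷ʳ c) (inject₁ i) ≡ lookup v i
lookup-∷ʳ-inject₁ (b ∷ v) c zero    = refl
lookup-∷ʳ-inject₁ (b ∷ v) c (suc i) = lookup-∷ʳ-inject₁ v c i

-- Each step removes one letter at the front, and the appended letters do not arrive there within
-- the first `d` steps.
head-iterate-step : ∀ {d} (t : Vertex (suc d) → Bool) k v (j : Fin (suc d)) → toℕ j ≡ k →
  head (iterate (step t) k v) ≡ lookup v j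
head-iterate-step t zero    (b ∷ s) zero    p = refl
head-iterate-step t (suc k) (b ∷ s) (suc j) p =
  trans (head-iterate-step t k (step t (b ∷ s)) (inject₁ j) (trans (FinP.toℕ-inject₁ j) (ℕP.suc-injective p)))
        (lookup-∷ʳ-inject₁ s (t (b ∷ s)) j)

%-suc-injective : ∀ n .{{_ : NonZero n}} {j k} → suc j % n ≡ suc k % n → j % n ≡ k % n
%-suc-injective (suc n) {j} {k} p = trans (sym (back j)) (trans (cong (λ z → (z + n) % suc n) p) (back k))
  where
  back : ∀ j → (suc j % suc n + n) % suc n ≡ j % suc n
  back j = trans (%-+ˡ (suc j) n (suc n)) (trans (cong (_% suc n) (sym (ℕP.+-suc j n))) (DM.[m+n]%n≡m%n j (suc n)))

-- If all twins disagree, the successor map is injective, and a tree with such a successor map is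
-- one cycle through all vertices by `Cyclic`.
Hamiltonian : ℕ → Set
Hamiltonian d = TwinTree {d} (λ _ → true)

module _ (d : ℕ) where

  private
    m = suc d
    M = 2 ^ m

    instance
      M≢0 : NonZero M
      M≢0 = ℕP.m^n≢0 2 m

    next : (Vertex d → Bool) → Vertex m → Vertex m
    next u = step (twin (λ _ → true) u)

    next-injective : ∀ u {v w} → next u v ≡ next u w → v ≡ w
    next-injective u {b ∷ s} {b′ ∷ s′} p with VecP.∷ʳ-injective s s′ p
    next-injective u {false ∷ s} {false ∷ s} p | refl , q = refl
    next-injective u {true  ∷ s} {true  ∷ s} p | refl , q = refl
    next-injective u {false ∷ s} {true  ∷ s} p | refl , q = contradiction (sym q) (BoolP.not-¬ refl)
    next-injective u {true  ∷ s} {false ∷ s} p | refl , q = contradiction q (BoolP.not-¬ refl)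

    factor : Word M → ℕ → Vertex m
    factor w k = window m (λ j → extend w (k + j))

    extend-cong-% : ∀ (w : Word M) {j k} → j % M ≡ k % M → extend w j ≡ extend w k
    extend-cong-% w p = cong w (mod-cong M p)

    +-cong-% : ∀ {j k} i → j % M ≡ k % M → (j + i) % M ≡ (k + i) % M
    +-cong-% {j} {k} i p = trans (sym (%-+ˡ j i M)) (trans (cong (λ z → (z + i) % M) p) (%-+ˡ k i M))

    factor-cong-% : ∀ w {j k} → j % M ≡ k % M → factor w j ≡ factor w k
    factor-cong-% w p = window-cong m (λ i → extend-cong-% w (+-cong-% i p))

    cycFactor≡ : ∀ (w : Word M) i j → cycFactor w i m j ≡ extend w (toℕ i + toℕ j)
    cycFactor≡ w i j = cong w (⊕≡mod i (toℕ j))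

    factor-suc : ∀ w k → factor w (suc k) ≡ tail (factor w k) ∷ʳ extend w (k + m)
    factor-suc w k = trans (window-cong m (λ j → cong (extend w) (sym (ℕP.+-suc k j))))
      (sym (window-∷ʳ d (λ j → extend w (k + suc j))))

  module _ (x : DeBruijn m) where

    private
      w = proj₁ x
      db = proj₂ x

      pos : Vertex m → Fin M
      pos v = proj₁ (db (lookup v))

      factor-pos : ∀ v → factor w (toℕ (pos v)) ≡ v
      factor-pos v = trans (VecP.tabulate-cong (λ j →
        trans (sym (cycFactor≡ w (pos v) j)) (proj₁ (proj₂ (db (lookup v))) j))) (VecP.tabulate∘lookup v)

      factor-unique : ∀ {i} v → factor w i ≡ v → i % M ≡ toℕ (pos v)
      factor-unique {i} v p = trans (sym (toℕ-mod i M)) (cong toℕ (proj₂ (proj₂ (db (lookup v))) (i mod M) (λ j →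
        trans (cycFactor≡ w (i mod M) j) (trans (sym (VecP.lookup∘tabulate (λ j → extend w (toℕ (i mod M) + toℕ j)) j))
          (cong (λ v → lookup v j) (trans (factor-cong-% w (trans (cong (_% M) (toℕ-mod i M)) (DM.m%n%n≡m%n i M))) p))))))

      factor-injective : ∀ {i j} → factor w i ≡ factor w j → i % M ≡ j % M
      factor-injective {i} {j} p = trans (factor-unique (factor w j) p) (sym (factor-unique (factor w j) refl))

    successor : Vertex d → Bool
    successor s = extend w (toℕ (pos (true ∷ s)) + m)

    successor-unique : ∀ k s → factor w k ≡ true ∷ s → extend w (k + m) ≡ successor s
    successor-unique k s p = extend-cong-% w (+-cong-% m (factor-injective (trans p (sym (factor-pos (true ∷ s))))))

    factor-next : ∀ k → factor w (suc k) ≡ next successor (factor w k)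
    factor-next k = trans (factor-suc w k) (go (factor w k) refl)
      where
      go : ∀ v → factor w k ≡ v → tail v ∷ʳ extend w (k + m) ≡ next successor v
      go (true  ∷ s) p = cong (s ∷ʳ_) (successor-unique k s p)
      -- If 0s were followed by the same letter as 1s, the factors one place further on would
      -- coincide. Uniqueness of factors would make the two positions equal modulo `M`, and hence 0s
      -- equal to 1s.
      go (false ∷ s) p = cong (s ∷ʳ_) (BoolP.¬-not λ e →
        let k′ = toℕ (pos (true ∷ s))
            same : factor w (suc k) ≡ factor w (suc k′)
            same = trans (factor-suc w k) (trans (cong₂ _∷ʳ_ (trans (cong tail p) (sym (cong tail (factor-pos (true ∷ s))))) e)
                     (sym (factor-suc w k′)))
        in case trans (sym p) (trans (factor-cong-% w (%-suc-injective M (factor-injective same))) (factor-pos (true ∷ s))) of λ ())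

    factor-iterate : ∀ k j → iterate (next successor) k (factor w j) ≡ factor w (j + k)
    factor-iterate zero    j = cong (factor w) (sym (ℕP.+-identityʳ j))
    factor-iterate (suc k) j = trans (cong (iterate (next successor) k) (sym (factor-next j)))
      (trans (factor-iterate k (suc j)) (cong (factor w) (sym (ℕP.+-suc j k))))

    -- Stepping moves the window along the cyclic word, and every position leads round to that of
    -- the root.
    successor-tree : IsTree (root m) (next successor)
    successor-tree v = let k , p = ⊕-shift (pos v) (pos (root m)) in k , (begin
      iterate (next successor) k v                          ≡⟨ cong (iterate (next successor) k) (factor-pos v) ⟨
      iterate (next successor) k (factor w (toℕ (pos v)))   ≡⟨ factor-iterate k (toℕ (pos v)) ⟩
      factor w (toℕ (pos v) + k)                            ≡⟨ factor-cong-% w (trans (sym (toℕ-⊕ (pos v) k)) (trans (cong toℕ p) (sym (toℕ-% (pos (root m)))))) ⟩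
      factor w (toℕ (pos (root m)))                         ≡⟨ factor-pos (root m) ⟩
      root m                                                ∎)
      where open ≡-Reasoning

    root-position : Σ ℕ λ r → ∀ k → iterate (next successor) k (root m) ≡ factor w (r + k)
    root-position = r , λ k → trans (cong (iterate (next successor) k) (sym (factor-pos (root m)))) (factor-iterate k r)
      where r = toℕ (pos (root m))

    factor-exists : ∀ v → Σ ℕ λ k → factor w k ≡ v
    factor-exists v = toℕ (pos v) , factor-pos v

  private
    to : DeBruijn m → Hamiltonian d
    to x = successor x , successor-tree x

    to-cong : ∀ x y → x ∼DB y → to x ≈₁ to y
    to-cong x@(w , _) y@(w′ , _) (k , p) s = let j , q = factor-exists y (true ∷ s) in
      trans (sym (successor-unique x (j + k) s (trans (window-cong m (λ i → trans (cong (extend w) (shuffle j k i)) (sym (shift (j + i))))) q)))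
        (trans (cong (extend w) (shuffle j k m)) (trans (sym (shift (j + m))) (successor-unique y j s q)))
      where
      shift : ∀ i → extend w′ i ≡ extend w (i + k)
      shift i = trans (p (i mod M)) (extend-shift w k i)
      shuffle : ∀ j k i → j + k + i ≡ j + i + k
      shuffle j k i = trans (ℕP.+-assoc j k i) (trans (cong (j +_) (ℕP.+-comm k i)) (sym (ℕP.+-assoc j i k)))

    -- Read from their occurrence of the root, at `r` and `r′`, both words spell the same orbit of
    -- the same successor map. They therefore differ by a rotation through r - r′.
    to-inj : ∀ x y → to x ≈₁ to y → x ∼DB y
    to-inj x@(w , _) y@(w′ , _) p = r + neg M r′ , λ i → sym (begin
      w (i ⊕ (r + neg M r′))                    ≡⟨ cong w (⊕≡mod i (r + neg M r′)) ⟩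
      extend w (toℕ i + (r + neg M r′))         ≡⟨ cong (extend w) (trans (ℕP.+-comm (toℕ i) _) (ℕP.+-assoc r _ _)) ⟩
      extend w (r + (neg M r′ + toℕ i))         ≡⟨ same (neg M r′ + toℕ i) ⟩
      extend w′ (r′ + (neg M r′ + toℕ i))       ≡⟨ cong (extend w′) (trans (sym (ℕP.+-assoc r′ _ _)) (ℕP.+-comm (r′ + neg M r′) (toℕ i))) ⟩
      extend w′ (toℕ i + (r′ + neg M r′))       ≡⟨ extend-% w′ (toℕ i) (r′ + neg M r′) (+-neg M r′) ⟩
      extend w′ (toℕ i)                         ≡⟨ cong w′ (mod-toℕ i) ⟩
      w′ i                                      ∎)
      where
      open ≡-Reasoning
      r = proj₁ (root-position x)
      r′ = proj₁ (root-position y)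
      head-factor : ∀ w k → head (factor w k) ≡ extend w k
      head-factor w k = cong (extend w) (ℕP.+-identityʳ k)
      same : ∀ k → extend w (r + k) ≡ extend w′ (r′ + k)
      same k = begin
        extend w (r + k)        ≡⟨ head-factor w (r + k) ⟨
        head (factor w (r + k)) ≡⟨ cong head (begin
          factor w (r + k)                              ≡⟨ proj₂ (root-position x) k ⟨
          iterate (next (successor x)) k (root m)       ≡⟨ iterate-cong (step-cong (twin-congʳ (λ _ → true) p)) k (root m) ⟩
          iterate (next (successor y)) k (root m)       ≡⟨ proj₂ (root-position y) k ⟩
          factor w′ (r′ + k)                            ∎) ⟩
        head (factor w′ (r′ + k)) ≡⟨ head-factor w′ (r′ + k) ⟩
        extend w′ (r′ + k)      ∎

    module _ (y : Hamiltonian d) where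

      u = proj₁ y
      tree = proj₂ y

      open Cyclic {M = M} code (decode m) code-injective (code-decode m) (next u) (next-injective u) tree

      trace : ℕ → Vertex m
      trace k = iterate (next u) k (root m)

      -- Consecutive vertices overlap in all but one letter, so their first letters spell a word
      -- whose factors are the vertices again. By `orbit-closes` this also holds across the end of
      -- the word.
      word : Word M
      word i = head (trace (toℕ i))

      extend-word : ∀ k → extend word k ≡ head (trace k)
      extend-word k = cong head (trans (cong trace (toℕ-mod k M)) (iterate-% k M orbit-closes))

      trace-lookup : ∀ k j → extend word (k + toℕ j) ≡ lookup (trace k) j
      trace-lookup k j = trans (extend-word (k + toℕ j)) (trans (cong head (iterate-+ (next u) k (toℕ j) (root m)))
        (head-iterate-step _ (toℕ j) (trace k) j refl))

      factor-word : ∀ k → factor word k ≡ trace k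
      factor-word k = trans (VecP.tabulate-cong (trace-lookup k)) (VecP.tabulate∘lookup (trace k))

      word-deBruijn : IsDeBruijn m word
      word-deBruijn v = let i , p = orbit-surjective (tabulate v) in
        i , (λ j → trans (reads i j) (trans (cong (λ z → lookup z j) p) (VecP.lookup∘tabulate v j))) ,
        λ j q → orbit-injective (trans (trans (sym (VecP.tabulate∘lookup (orbit j)))
          (VecP.tabulate-cong (λ i → trans (sym (reads j i)) (q i)))) (sym p))
        where
        reads : ∀ i j → cycFactor word i m j ≡ lookup (orbit i) j
        reads i j = trans (cycFactor≡ word i j) (trace-lookup (toℕ i) j)

      to-surj : Σ (DeBruijn m) λ x → to x ≈₁ y
      to-surj = x , λ s → let k , p = factor-exists x (true ∷ s) in
        trans (sym (successor-unique x k s p)) (proj₂ (VecP.∷ʳ-injective s s (begin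
          s ∷ʳ extend word (k + m)               ≡⟨ cong (λ v → tail v ∷ʳ extend word (k + m)) p ⟨
          tail (factor word k) ∷ʳ extend word (k + m) ≡⟨ factor-suc word k ⟨
          factor word (suc k)                    ≡⟨ factor-word (suc k) ⟩
          trace (suc k)                          ≡⟨ cong trace (ℕP.+-comm 1 k) ⟩
          trace (k + 1)                          ≡⟨ iterate-+ (next u) k 1 (root m) ⟩
          next u (trace k)                       ≡⟨ cong (next u) (trans (sym (factor-word k)) p) ⟩
          s ∷ʳ u s                               ∎)))
        where
        open ≡-Reasoning
        x = word , word-deBruijn

  DeBruijn≃Hamiltonian : QuotBij (DeBruijn m) _∼DB_ (Hamiltonian d) _≈₁_
  DeBruijn≃Hamiltonian = record
    { to = to ; to-cong = λ {x} {y} → to-cong x y ; to-inj = λ {x} {y} → to-inj x y ; to-surj = to-surj }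

-- Fields with 2^k elements: characteristic 2 and Fermat's theorem.

∃⊎∀< : ∀ n (c : ℕ → Bool) → (Σ[ j ∈ ℕ ] j < n × c j ≡ true) ⊎ (∀ j → j < n → c j ≡ false)
∃⊎∀< zero    c = inj₂ λ _ ()
∃⊎∀< (suc n) c with c 0 in c₀ | ∃⊎∀< n (c ∘ suc)
... | true  | _ = inj₁ (0 , s≤s z≤n , c₀)
... | false | inj₁ (j , j<n , p) = inj₁ (suc j , s≤s j<n , p)
... | false | inj₂ p = inj₂ λ { zero _ → c₀ ; (suc j) (s≤s j<n) → p j j<n }

xor≡false : ∀ a b → a xor b ≡ false → a ≡ b
xor≡false false b p = sym p
xor≡false true  b p = sym (BoolP.not-injective p)

module FieldProperties {c ℓ : Level} (F : Field c ℓ) where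

  open Field F
    using (Carrier; _≈_; 0#; 1#; setoid; 0≉1; inverse; commutativeSemiring; +-commutativeMonoid; *-commutativeMonoid)
    renaming ( _+_ to _+ᶠ_; _*_ to _*ᶠ_; refl to ≈refl; sym to ≈sym; trans to ≈trans; +-cong to +ᶠ-cong; *-cong to *ᶠ-cong
             ; +-assoc to +ᶠ-assoc; +-comm to +ᶠ-comm; *-assoc to *ᶠ-assoc; *-comm to *ᶠ-comm
             ; +-identityˡ to +ᶠ-identityˡ; +-identityʳ to +ᶠ-identityʳ; *-identityˡ to *ᶠ-identityˡ; *-identityʳ to *ᶠ-identityʳ
             ; zeroˡ to 0*; zeroʳ to *0; distribˡ to *ᶠ-distribˡ; distribʳ to *ᶠ-distribʳ
             ; -_ to -ᶠ_; -‿inverseʳ to +ᶠ-inverseʳ; -‿inverseˡ to +ᶠ-inverseˡ; reflexive to ≈reflexive) public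
  open import Relation.Binary.Reasoning.Setoid setoid

  _≉_ : Carrier → Carrier → Set ℓ
  x ≉ y = ¬ (x ≈ y)

  *ᶠ-cancel-0 : ∀ {x y} → x ≉ 0# → x *ᶠ y ≈ 0# → y ≈ 0#
  *ᶠ-cancel-0 {x} {y} x≉0 p = let z , q = inverse x x≉0 in begin
    y               ≈⟨ *ᶠ-identityˡ y ⟨
    1# *ᶠ y         ≈⟨ *ᶠ-cong (≈trans (≈sym q) (*ᶠ-comm x z)) ≈refl ⟩
    z *ᶠ x *ᶠ y     ≈⟨ *ᶠ-assoc z x y ⟩
    z *ᶠ (x *ᶠ y)   ≈⟨ *ᶠ-cong ≈refl p ⟩
    z *ᶠ 0#         ≈⟨ *0 z ⟩
    0#              ∎

  *ᶠ-cancelʳ : ∀ {x y z} → z ≉ 0# → x *ᶠ z ≈ y *ᶠ z → x ≈ y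
  *ᶠ-cancelʳ {x} {y} {z} z≉0 p = let w , q = inverse z z≉0 in begin
    x               ≈⟨ *ᶠ-identityʳ x ⟨
    x *ᶠ 1#         ≈⟨ *ᶠ-cong ≈refl q ⟨
    x *ᶠ (z *ᶠ w)   ≈⟨ *ᶠ-assoc x z w ⟨
    x *ᶠ z *ᶠ w     ≈⟨ *ᶠ-cong p ≈refl ⟩
    y *ᶠ z *ᶠ w     ≈⟨ *ᶠ-assoc y z w ⟩
    y *ᶠ (z *ᶠ w)   ≈⟨ *ᶠ-cong ≈refl q ⟩
    y *ᶠ 1#         ≈⟨ *ᶠ-identityʳ y ⟩
    y               ∎

  _^ᶠ_ : Carrier → ℕ → Carrier
  _^ᶠ_ = pow F

  ^ᶠ-cong : ∀ {x y} n → x ≈ y → x ^ᶠ n ≈ y ^ᶠ n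
  ^ᶠ-cong zero    p = ≈refl
  ^ᶠ-cong (suc n) p = *ᶠ-cong p (^ᶠ-cong n p)

  ^ᶠ-+ : ∀ x m n → x ^ᶠ (m + n) ≈ x ^ᶠ m *ᶠ x ^ᶠ n
  ^ᶠ-+ x zero    n = ≈sym (*ᶠ-identityˡ _)
  ^ᶠ-+ x (suc m) n = ≈trans (*ᶠ-cong ≈refl (^ᶠ-+ x m n)) (≈sym (*ᶠ-assoc _ _ _))

  ^ᶠ-* : ∀ x m n → x ^ᶠ (n * m) ≈ (x ^ᶠ m) ^ᶠ n
  ^ᶠ-* x m zero    = ≈refl
  ^ᶠ-* x m (suc n) = ≈trans (^ᶠ-+ x m (n * m)) (*ᶠ-cong ≈refl (^ᶠ-* x m n))

  0^ᶠ : ∀ n .{{_ : NonZero n}} → 0# ^ᶠ n ≈ 0#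
  0^ᶠ (suc n) = 0* _

  module +Sum = CommutativeMonoidSum +-commutativeMonoid
  module *Sum = CommutativeMonoidSum *-commutativeMonoid

  prod = *Sum.sum

  prod-const : ∀ n a → prod {n} (λ _ → a) ≈ a ^ᶠ n
  prod-const zero    a = ≈refl
  prod-const (suc n) a = *ᶠ-cong ≈refl (prod-const n a)

  prod-1 : ∀ {n} (t : Fin n → Carrier) → (∀ i → t i ≈ 1#) → prod t ≈ 1#
  prod-1 {zero}  t p = ≈refl
  prod-1 {suc n} t p = ≈trans (*ᶠ-cong (p zero) (prod-1 (t ∘ suc) (p ∘ suc))) (*ᶠ-identityˡ 1#)

  prod-single : ∀ {n} (t : Fin n → Carrier) i → (∀ j → j ≢ i → t j ≈ 1#) → prod t ≈ t i
  prod-single t zero    p = ≈trans (*ᶠ-cong ≈refl (prod-1 (t ∘ suc) (λ j → p (suc j) λ ()))) (*ᶠ-identityʳ _)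
  prod-single t (suc i) p = ≈trans (*ᶠ-cong (p zero λ ()) (prod-single (t ∘ suc) i (λ j ne → p (suc j) (ne ∘ FinP.suc-injective)))) (*ᶠ-identityˡ _)

  prod-nonzero : ∀ {n} (t : Fin n → Carrier) → (∀ i → t i ≉ 0#) → prod t ≉ 0#
  prod-nonzero {zero}  t p q = 0≉1 (≈sym q)
  prod-nonzero {suc n} t p q = prod-nonzero (t ∘ suc) (p ∘ suc) (*ᶠ-cancel-0 (p zero) q)

  module Order {k} (order : HasOrder F (2 ^ k)) where

    private
      module O = Bijection order

    q : ℕ
    q = 2 ^ k

    instance
      q≢0 : NonZero q
      q≢0 = ℕP.m^n≢0 2 k

    el : Fin q → Carrier
    el = O.to

    index : Carrier → Fin q
    index x = proj₁ (O.surjective x)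

    el-index : ∀ x → el (index x) ≈ x
    el-index x = proj₂ (O.surjective x) refl

    el-injective : ∀ {i j} → el i ≈ el j → i ≡ j
    el-injective = O.injective

    index-cong : ∀ {x y} → x ≈ y → index x ≡ index y
    index-cong {x} {y} p = el-injective (≈trans (el-index x) (≈trans p (≈sym (el-index y))))

    index-el : ∀ i → index (el i) ≡ i
    index-el i = el-injective (el-index (el i))

    _≟ᶠ_ : ∀ x y → Dec (x ≈ y)
    x ≟ᶠ y = map′ (λ p → ≈trans (≈sym (el-index x)) (≈trans (≈reflexive (cong el p)) (el-index y))) index-cong (index x FinP.≟ index y)

    module _ (φ ψ : Carrier → Carrier) (φ-cong : ∀ {x y} → x ≈ y → φ x ≈ φ y) (ψ-cong : ∀ {x y} → x ≈ y → ψ x ≈ ψ y)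
      (φψ : ∀ x → φ (ψ x) ≈ x) (ψφ : ∀ x → ψ (φ x) ≈ x) where

      permute : Permutation q q
      permute = permutation (index ∘ φ ∘ el) (index ∘ ψ ∘ el)
        (λ i → trans (index-cong (≈trans (φ-cong (el-index _)) (φψ _))) (index-el i))
        (λ i → trans (index-cong (≈trans (ψ-cong (el-index _)) (ψφ _))) (index-el i))

      prod-permute : ∀ (h : Carrier → Carrier) → (∀ {x y} → x ≈ y → h x ≈ h y) → prod (h ∘ el) ≈ prod (h ∘ φ ∘ el)
      prod-permute h h-cong = ≈trans (*Sum.sum-permute (h ∘ el) permute) (*Sum.sum-cong-≋ {n = q} (λ i → h-cong (el-index (φ (el i)))))

      sum-permute : +Sum.sum el ≈ +Sum.sum (φ ∘ el)
      sum-permute = ≈trans (+Sum.sum-permute el permute) (+Sum.sum-cong-≋ {n = q} (λ i → el-index (φ (el i))))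

    open import Algebra.Properties.Semiring.Mult (Field.semiring F) using (×1-homo-*) renaming (_×_ to _·_)

    sum-1 : ∀ n → +Sum.sum {n} (λ _ → 1#) ≈ n · 1#
    sum-1 zero    = ≈refl
    sum-1 (suc n) = +ᶠ-cong ≈refl (sum-1 n)

    +ᶠ-cancelˡ-0 : ∀ {x y} → x ≈ x +ᶠ y → y ≈ 0#
    +ᶠ-cancelˡ-0 {x} {y} p = begin
      y                   ≈⟨ +ᶠ-identityˡ y ⟨
      0# +ᶠ y             ≈⟨ +ᶠ-cong (+ᶠ-inverseˡ x) ≈refl ⟨
      (-ᶠ x) +ᶠ x +ᶠ y    ≈⟨ +ᶠ-assoc _ _ _ ⟩
      (-ᶠ x) +ᶠ (x +ᶠ y)  ≈⟨ +ᶠ-cong ≈refl p ⟨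
      (-ᶠ x) +ᶠ x         ≈⟨ +ᶠ-inverseˡ x ⟩
      0#                  ∎

    -- Translation by 1 permutes the field, so the sum of all elements is unchanged by adding q copies of 1.
    q·1≈0 : q · 1# ≈ 0#
    q·1≈0 = ≈trans (≈sym (sum-1 q)) (+ᶠ-cancelˡ-0 (≈trans
      (sum-permute (_+ᶠ 1#) (_+ᶠ (-ᶠ 1#)) (λ p → +ᶠ-cong p ≈refl) (λ p → +ᶠ-cong p ≈refl)
        (λ x → ≈trans (+ᶠ-assoc _ _ _) (≈trans (+ᶠ-cong ≈refl (+ᶠ-inverseˡ 1#)) (+ᶠ-identityʳ x)))
        (λ x → ≈trans (+ᶠ-assoc _ _ _) (≈trans (+ᶠ-cong ≈refl (+ᶠ-inverseʳ 1#)) (+ᶠ-identityʳ x))))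
      (+Sum.∑-distrib-+ el (λ _ → 1#))))

    -- The multiple 2^k of 1 is the k-th power of `2 · 1#`, and a nonzero factor can be cancelled
    -- each time.
    2·1≈0 : 2 · 1# ≈ 0#
    2·1≈0 = go k q·1≈0
      where
      go : ∀ k → (2 ^ k) · 1# ≈ 0# → 2 · 1# ≈ 0#
      go zero    p = contradiction (≈sym (≈trans (≈sym (+ᶠ-identityʳ 1#)) p)) 0≉1
      go (suc k) p with (2 · 1#) ≟ᶠ 0#
      ... | yes e = e
      ... | no ne = go k (*ᶠ-cancel-0 ne (≈trans (≈sym (×1-homo-* 2 (2 ^ k))) p))

    x+x≈0 : ∀ x → x +ᶠ x ≈ 0#
    x+x≈0 x = begin
      x +ᶠ x                    ≈⟨ +ᶠ-cong (*ᶠ-identityʳ x) (≈trans (*ᶠ-cong ≈refl (+ᶠ-identityʳ 1#)) (*ᶠ-identityʳ x)) ⟨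
      x *ᶠ 1# +ᶠ x *ᶠ (1# +ᶠ 0#) ≈⟨ *ᶠ-distribˡ x _ _ ⟨
      x *ᶠ (2 · 1#)             ≈⟨ *ᶠ-cong ≈refl 2·1≈0 ⟩
      x *ᶠ 0#                   ≈⟨ *0 x ⟩
      0#                        ∎

    private
      -- An exception at `x ≈ 0#` allows products to range over the whole field instead of its
      -- nonzero elements.
      replace0 : Carrier → Carrier → Carrier → Carrier
      replace0 b x y with x ≟ᶠ 0#
      ... | yes _ = b
      ... | no  _ = y

      replace0-cong : ∀ b {x y z w} → x ≈ y → z ≈ w → replace0 b x z ≈ replace0 b y w
      replace0-cong b {x} {y} p r with x ≟ᶠ 0# | y ≟ᶠ 0#
      ... | yes _ | yes _ = ≈refl
      ... | no  _ | no  _ = r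
      ... | yes e | no ne = contradiction (≈trans (≈sym p) e) ne
      ... | no ne | yes e = contradiction (≈trans p e) ne

    -- Multiplication by a permutes the field; taking products of all elements, with 0 replaced by 1, gives
    -- a^(q-1) = 1, and the factor for 0 supplies the missing a.
    fermat : ∀ a → a ^ᶠ q ≈ a
    fermat a with a ≟ᶠ 0#
    ... | yes a≈0 = ≈trans (^ᶠ-cong q a≈0) (≈trans (0^ᶠ q) (≈sym a≈0))
    ... | no  a≉0 = *ᶠ-cancelʳ (prod-nonzero (u ∘ el) (u-nonzero ∘ el)) (begin
      a ^ᶠ q *ᶠ prod (u ∘ el)                      ≈⟨ *ᶠ-cong (prod-const q a) ≈refl ⟨
      prod {q} (λ _ → a) *ᶠ prod (u ∘ el)          ≈⟨ *Sum.∑-distrib-+ (λ _ → a) (u ∘ el) ⟨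
      prod (λ i → a *ᶠ u (el i))                   ≈⟨ *Sum.sum-cong-≋ (λ i → scale (el i)) ⟩
      prod (λ i → h (el i) *ᶠ u (a *ᶠ el i))       ≈⟨ *Sum.∑-distrib-+ (h ∘ el) (λ i → u (a *ᶠ el i)) ⟩
      prod (h ∘ el) *ᶠ prod (λ i → u (a *ᶠ el i))  ≈⟨ *ᶠ-cong prod-h (≈sym (prod-permute (a *ᶠ_) (b *ᶠ_) (*ᶠ-cong ≈refl) (*ᶠ-cong ≈refl)
                                                        (cancel (proj₂ (inverse a a≉0))) (cancel (≈trans (*ᶠ-comm b a) (proj₂ (inverse a a≉0))))
                                                        u (λ p → replace0-cong 1# p p))) ⟩
      a *ᶠ prod (u ∘ el)                           ∎)
      where
      b = proj₁ (inverse a a≉0)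
      cancel : ∀ {a b} → a *ᶠ b ≈ 1# → ∀ x → a *ᶠ (b *ᶠ x) ≈ x
      cancel p x = ≈trans (≈sym (*ᶠ-assoc _ _ x)) (≈trans (*ᶠ-cong p ≈refl) (*ᶠ-identityˡ x))
      u h : Carrier → Carrier
      u x = replace0 1# x x
      h x = replace0 a x 1#
      u-nonzero : ∀ x → u x ≉ 0#
      u-nonzero x with x ≟ᶠ 0#
      ... | yes _ = 0≉1 ∘ ≈sym
      ... | no ne = ne
      scale : ∀ x → a *ᶠ u x ≈ h x *ᶠ u (a *ᶠ x)
      scale x with x ≟ᶠ 0# | (a *ᶠ x) ≟ᶠ 0#
      ... | yes _ | yes _ = ≈refl
      ... | no _  | no _  = ≈sym (*ᶠ-identityˡ _)
      ... | yes e | no ne = contradiction (≈trans (*ᶠ-cong ≈refl e) (*0 a)) ne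
      ... | no ne | yes e = contradiction (*ᶠ-cancel-0 a≉0 e) ne
      prod-h : prod (h ∘ el) ≈ a
      prod-h = ≈trans (prod-single (h ∘ el) (index 0#) others) here′
        where
        others : ∀ j → j ≢ index 0# → h (el j) ≈ 1#
        others j ne with el j ≟ᶠ 0#
        ... | yes e = contradiction (trans (sym (index-el j)) (index-cong e)) ne
        ... | no _  = ≈refl
        here′ : h (el (index 0#)) ≈ a
        here′ with el (index 0#) ≟ᶠ 0#
        ... | yes _ = ≈refl
        ... | no ne = contradiction (el-index 0#) ne

module NormalBases {c ℓ : Level} (F : Field c ℓ) (d : ℕ) (order : HasOrder F (2 ^ (2 ^ d))) where

  open FieldProperties F
  open Order {2 ^ d} order
  open import Relation.Binary.Reasoning.Setoid setoid
  open SemiringSolver commutativeSemiring using (solve; _:+_; _:*_; _:=_)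

  N : ℕ
  N = 2 ^ d

  private instance
    N≢0 : NonZero N
    N≢0 = ℕP.m^n≢0 2 d

  -- Polynomial functions and their roots in characteristic 2.

  +ᶠ-cancelʳ : ∀ {x y z} → x +ᶠ z ≈ y +ᶠ z → x ≈ y
  +ᶠ-cancelʳ {x} {y} {z} p = begin
    x               ≈⟨ undo x ⟨
    x +ᶠ z +ᶠ z     ≈⟨ +ᶠ-cong p ≈refl ⟩
    y +ᶠ z +ᶠ z     ≈⟨ undo y ⟩
    y               ∎
    where
    undo : ∀ x → x +ᶠ z +ᶠ z ≈ x
    undo x = ≈trans (+ᶠ-assoc x z z) (≈trans (+ᶠ-cong ≈refl (x+x≈0 z)) (+ᶠ-identityʳ x))

  +≈0⇒≈ : ∀ {x y} → x +ᶠ y ≈ 0# → x ≈ y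
  +≈0⇒≈ {x} {y} p = +ᶠ-cancelʳ (≈trans p (≈sym (x+x≈0 y)))

  -- f is a polynomial function of degree at most n whose coefficient of x^n is a.
  Polynomial : Carrier → ℕ → (Carrier → Carrier) → Set _
  Polynomial a zero    f = ∀ x → f x ≈ a
  Polynomial a (suc n) f = Σ (Carrier → Carrier) λ g → Polynomial a n g × Σ Carrier λ b → ∀ x → f x ≈ x *ᶠ g x +ᶠ b

  Polynomial-cong : ∀ {a f g} n → (∀ x → g x ≈ f x) → Polynomial a n f → Polynomial a n g
  Polynomial-cong zero    p h x               = ≈trans (p x) (h x)
  Polynomial-cong (suc n) p (h , poly , b , e) = h , poly , b , λ x → ≈trans (p x) (e x)

  Polynomial-coeff : ∀ {a b f} n → a ≈ b → Polynomial a n f → Polynomial b n f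
  Polynomial-coeff zero    p h x                = ≈trans (h x) p
  Polynomial-coeff (suc n) p (h , poly , e)     = h , Polynomial-coeff n p poly , e

  Polynomial-+ : ∀ {a b f g} n → Polynomial a n f → Polynomial b n g → Polynomial (a +ᶠ b) n (λ x → f x +ᶠ g x)
  Polynomial-+ zero    p q x = +ᶠ-cong (p x) (q x)
  Polynomial-+ {f = f} {g} (suc n) (f′ , p , b , e) (g′ , q , b′ , e′) =
    (λ x → f′ x +ᶠ g′ x) , Polynomial-+ n p q , b +ᶠ b′ , λ x → ≈trans (+ᶠ-cong (e x) (e′ x))
      (solve 5 (λ x y z b b′ → (x :* y :+ b) :+ (x :* z :+ b′) := x :* (y :+ z) :+ (b :+ b′)) ≈refl x (f′ x) (g′ x) b b′)

  Polynomial-^ : ∀ n → Polynomial 1# n (_^ᶠ n)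
  Polynomial-^ zero    x = ≈refl
  Polynomial-^ (suc n) = (_^ᶠ n) , Polynomial-^ n , 0# , λ x → ≈sym (+ᶠ-identityʳ _)

  Polynomial-suc : ∀ {a f} n → Polynomial a n f → Polynomial 0# (suc n) f
  Polynomial-suc {a} zero    p = (λ _ → 0#) , (λ _ → ≈refl) , a , λ x →
    ≈trans (p x) (≈sym (≈trans (+ᶠ-cong (*0 x) ≈refl) (+ᶠ-identityˡ a)))
  Polynomial-suc (suc n) (g , p , b , e) = g , Polynomial-suc n p , b , e

  Polynomial-≤ : ∀ {f m n} → m ≤ n → Polynomial 0# m f → Polynomial 0# n f
  Polynomial-≤ {f} {m} m≤n p with ℕP.m≤n⇒∃[o]m+o≡n m≤n
  ... | o , refl = raise o
    where
    raise : ∀ o → Polynomial 0# (m + o) f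
    raise zero    = subst (λ k → Polynomial 0# k f) (sym (ℕP.+-identityʳ m)) p
    raise (suc o) = subst (λ k → Polynomial 0# k f) (sym (ℕP.+-suc m o)) (Polynomial-suc (m + o) (raise o))

  -- In characteristic 2 the linear factor of the root r is x + r.
  divide : ∀ {a f} n → Polynomial a (suc n) f → ∀ r →
    Σ (Carrier → Carrier) λ g → Polynomial a n g × (∀ x → f x ≈ f r +ᶠ (x +ᶠ r) *ᶠ g x)
  divide {a} {f} zero (g , p , b , e) r = g , p , λ x → begin
    f x                                      ≈⟨ e x ⟩
    x *ᶠ g x +ᶠ b                            ≈⟨ +ᶠ-cong (shift (x *ᶠ g x) r (g x)) ≈refl ⟩
    r *ᶠ g x +ᶠ (r *ᶠ g x +ᶠ x *ᶠ g x) +ᶠ b  ≈⟨ solve 4 (λ x r y b → (r :* y :+ (r :* y :+ x :* y)) :+ b := (r :* y :+ b) :+ (x :+ r) :* y) ≈refl x r (g x) b ⟩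
    r *ᶠ g x +ᶠ b +ᶠ (x +ᶠ r) *ᶠ g x         ≈⟨ +ᶠ-cong (+ᶠ-cong (*ᶠ-cong ≈refl (≈trans (p x) (≈sym (p r)))) ≈refl) ≈refl ⟩
    r *ᶠ g r +ᶠ b +ᶠ (x +ᶠ r) *ᶠ g x         ≈⟨ +ᶠ-cong (e r) ≈refl ⟨
    f r +ᶠ (x +ᶠ r) *ᶠ g x                   ∎
    where
    shift : ∀ z r y → z ≈ r *ᶠ y +ᶠ (r *ᶠ y +ᶠ z)
    shift z r y = ≈sym (≈trans (≈sym (+ᶠ-assoc _ _ _)) (≈trans (+ᶠ-cong (x+x≈0 _) ≈refl) (+ᶠ-identityˡ z)))
  divide {a} {f} (suc n) (g , p , b , e) r with divide n p r
  ... | h , q , e′ = (λ x → x *ᶠ h x +ᶠ g r) , (h , q , g r , λ x → ≈refl) , λ x → begin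
    f x                                              ≈⟨ e x ⟩
    x *ᶠ g x +ᶠ b                                    ≈⟨ +ᶠ-cong (*ᶠ-cong ≈refl (e′ x)) ≈refl ⟩
    x *ᶠ (g r +ᶠ (x +ᶠ r) *ᶠ h x) +ᶠ b               ≈⟨ +ᶠ-identityˡ _ ⟨
    0# +ᶠ (x *ᶠ (g r +ᶠ (x +ᶠ r) *ᶠ h x) +ᶠ b)       ≈⟨ +ᶠ-cong (x+x≈0 (r *ᶠ g r)) ≈refl ⟨
    r *ᶠ g r +ᶠ r *ᶠ g r +ᶠ (x *ᶠ (g r +ᶠ (x +ᶠ r) *ᶠ h x) +ᶠ b)
      ≈⟨ solve 5 (λ x r y z b → (r :* y :+ r :* y) :+ (x :* (y :+ (x :+ r) :* z) :+ b) := (r :* y :+ b) :+ (x :+ r) :* (x :* z :+ y)) ≈refl x r (g r) (h x) b ⟩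
    r *ᶠ g r +ᶠ b +ᶠ (x +ᶠ r) *ᶠ (x *ᶠ h x +ᶠ g r)   ≈⟨ +ᶠ-cong (e r) ≈refl ⟨
    f r +ᶠ (x +ᶠ r) *ᶠ (x *ᶠ h x +ᶠ g r)             ∎

  -- Dividing by the linear factor of the first root keeps the leading coefficient. At every other
  -- root this factor is nonzero, so the quotient vanishes there.
  few-roots : ∀ {a f} n → a ≉ 0# → Polynomial a n f → (r : Fin (suc n) → Carrier) →
    (∀ {i j} → r i ≈ r j → i ≡ j) → ¬ (∀ i → f (r i) ≈ 0#)
  few-roots zero    a≉0 p r r-inj roots = a≉0 (≈trans (≈sym (p (r zero))) (roots zero))
  few-roots {f = f} (suc n) a≉0 p r r-inj roots with divide n p (r zero)
  ... | g , q , e = few-roots n a≉0 q (r ∘ suc) (FinP.suc-injective ∘ r-inj) λ i →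
    *ᶠ-cancel-0 (λ s → case r-inj {suc i} {zero} (+≈0⇒≈ s) of λ ()) (begin
      (r (suc i) +ᶠ r zero) *ᶠ g (r (suc i))                 ≈⟨ +ᶠ-identityˡ _ ⟨
      0# +ᶠ (r (suc i) +ᶠ r zero) *ᶠ g (r (suc i))           ≈⟨ +ᶠ-cong (roots zero) ≈refl ⟨
      f (r zero) +ᶠ (r (suc i) +ᶠ r zero) *ᶠ g (r (suc i))   ≈⟨ e (r (suc i)) ⟨
      f (r (suc i))                                          ≈⟨ roots (suc i) ⟩
      0#                                                     ∎)

  -- Powers of the Frobenius map and binary combinations of conjugates.

  ∑ : ℕ → (ℕ → Carrier) → Carrier
  ∑ zero    f = 0#
  ∑ (suc n) f = f 0 +ᶠ ∑ n (f ∘ suc)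

  ∑-cong< : ∀ n {f g} → (∀ i → i < n → f i ≈ g i) → ∑ n f ≈ ∑ n g
  ∑-cong< zero    p = ≈refl
  ∑-cong< (suc n) p = +ᶠ-cong (p 0 (s≤s z≤n)) (∑-cong< n (λ i i<n → p (suc i) (s≤s i<n)))

  ∑-cong : ∀ n {f g} → (∀ i → f i ≈ g i) → ∑ n f ≈ ∑ n g
  ∑-cong n p = ∑-cong< n (λ i _ → p i)

  ∑-split : ∀ m n f → ∑ (m + n) f ≈ ∑ m f +ᶠ ∑ n (f ∘ (m +_))
  ∑-split zero    n f = ≈sym (+ᶠ-identityˡ _)
  ∑-split (suc m) n f = ≈trans (+ᶠ-cong ≈refl (∑-split m n (f ∘ suc))) (≈sym (+ᶠ-assoc _ _ _))

  ∑-last : ∀ n f → ∑ (suc n) f ≈ ∑ n f +ᶠ f n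
  ∑-last zero    f = ≈trans (+ᶠ-identityʳ _) (≈sym (+ᶠ-identityˡ _))
  ∑-last (suc n) f = ≈trans (+ᶠ-cong ≈refl (∑-last n (f ∘ suc))) (≈sym (+ᶠ-assoc _ _ _))

  ∑-+ : ∀ n f g → ∑ n f +ᶠ ∑ n g ≈ ∑ n (λ i → f i +ᶠ g i)
  ∑-+ zero    f g = +ᶠ-identityˡ 0#
  ∑-+ (suc n) f g = ≈trans
    (solve 4 (λ a b c d → (a :+ b) :+ (c :+ d) := (a :+ c) :+ (b :+ d)) ≈refl (f 0) (∑ n (f ∘ suc)) (g 0) (∑ n (g ∘ suc)))
    (+ᶠ-cong ≈refl (∑-+ n (f ∘ suc) (g ∘ suc)))

  ∑-periodic : ∀ n k {f} → (∀ i → f (n + i) ≈ f i) → ∑ n (f ∘ (_+ k)) ≈ ∑ n f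
  ∑-periodic n zero    {f} per = ∑-cong n (λ i → ≈reflexive (cong f (ℕP.+-identityʳ i)))
  ∑-periodic n (suc k) {f} per = begin
    ∑ n (f ∘ (_+ suc k))  ≈⟨ ∑-cong n (λ i → ≈reflexive (cong f (ℕP.+-suc i k))) ⟩
    ∑ n (λ i → f (suc (i + k))) ≈⟨ ∑-periodic n k (λ i → ≈trans (≈reflexive (cong f (sym (ℕP.+-suc n i)))) (per (suc i))) ⟩
    ∑ n (f ∘ suc)         ≈⟨ +ᶠ-cancelʳ (begin
      ∑ n (f ∘ suc) +ᶠ f 0  ≈⟨ +ᶠ-comm _ _ ⟩
      ∑ (suc n) f           ≈⟨ ∑-last n f ⟩
      ∑ n f +ᶠ f n          ≈⟨ +ᶠ-cong ≈refl (≈trans (≈reflexive (cong f (sym (ℕP.+-identityʳ n)))) (per 0)) ⟩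
      ∑ n f +ᶠ f 0          ∎) ⟩
    ∑ n f                 ∎

  -- The i-th power of the Frobenius automorphism; `conj F N γ i` is `φ (toℕ i) γ`.
  φ : ℕ → Carrier → Carrier
  φ i x = x ^ᶠ (2 ^ i)

  φ-cong : ∀ i {x y} → x ≈ y → φ i x ≈ φ i y
  φ-cong i = ^ᶠ-cong (2 ^ i)

  φ-0 : ∀ x → φ 0 x ≈ x
  φ-0 = *ᶠ-identityʳ

  φ-φ : ∀ i j x → φ i (φ j x) ≈ φ (i + j) x
  φ-φ i j x = ≈trans (≈sym (^ᶠ-* x (2 ^ j) (2 ^ i))) (≈reflexive (cong (x ^ᶠ_) (sym (ℕP.^-distribˡ-+-* 2 i j))))

  φ-comm : ∀ i j x → φ i (φ j x) ≈ φ j (φ i x)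
  φ-comm i j x = ≈trans (φ-φ i j x) (≈trans (≈reflexive (cong (λ k → φ k x) (ℕP.+-comm i j))) (≈sym (φ-φ j i x)))

  -- The two mixed terms of the square cancel in characteristic 2; the general case iterates
  -- squaring.
  φ-+ : ∀ i x y → φ i (x +ᶠ y) ≈ φ i x +ᶠ φ i y
  φ-+ zero    x y = ≈trans (φ-0 _) (≈sym (+ᶠ-cong (φ-0 x) (φ-0 y)))
  φ-+ (suc i) x y = begin
    φ (1 + i) (x +ᶠ y)               ≈⟨ φ-φ 1 i (x +ᶠ y) ⟨
    φ 1 (φ i (x +ᶠ y))               ≈⟨ φ-cong 1 (φ-+ i x y) ⟩
    φ 1 (φ i x +ᶠ φ i y)             ≈⟨ square (φ i x) (φ i y) ⟩
    φ 1 (φ i x) +ᶠ φ 1 (φ i y)       ≈⟨ +ᶠ-cong (φ-φ 1 i x) (φ-φ 1 i y) ⟩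
    φ (1 + i) x +ᶠ φ (1 + i) y       ∎
    where
    φ1 : ∀ x → φ 1 x ≈ x *ᶠ x
    φ1 x = *ᶠ-cong ≈refl (*ᶠ-identityʳ x)
    square : ∀ x y → φ 1 (x +ᶠ y) ≈ φ 1 x +ᶠ φ 1 y
    square x y = begin
      φ 1 (x +ᶠ y)                                   ≈⟨ φ1 _ ⟩
      (x +ᶠ y) *ᶠ (x +ᶠ y)                           ≈⟨ solve 2 (λ x y → (x :+ y) :* (x :+ y) := (x :* y :+ x :* y) :+ (x :* x :+ y :* y)) ≈refl x y ⟩
      x *ᶠ y +ᶠ x *ᶠ y +ᶠ (x *ᶠ x +ᶠ y *ᶠ y)         ≈⟨ +ᶠ-cong (x+x≈0 _) ≈refl ⟩
      0# +ᶠ (x *ᶠ x +ᶠ y *ᶠ y)                       ≈⟨ +ᶠ-identityˡ _ ⟩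
      x *ᶠ x +ᶠ y *ᶠ y                               ≈⟨ +ᶠ-cong (φ1 x) (φ1 y) ⟨
      φ 1 x +ᶠ φ 1 y                                 ∎

  φ-zero : ∀ i → φ i 0# ≈ 0#
  φ-zero i = 0^ᶠ (2 ^ i) {{ℕP.m^n≢0 2 i}}

  φ-N : ∀ x → φ N x ≈ x
  φ-N = fermat

  φ-*N : ∀ k x → φ (k * N) x ≈ x
  φ-*N zero    x = φ-0 x
  φ-*N (suc k) x = ≈trans (≈sym (φ-φ N (k * N) x)) (≈trans (φ-N _) (φ-*N k x))

  φ-% : ∀ k x → φ (k % N) x ≈ φ k x
  φ-% k x = ≈sym (begin
    φ k x                             ≡⟨ cong (λ z → φ z x) (DM.m≡m%n+[m/n]*n k N) ⟩
    φ (k % N + k / N * N) x           ≈⟨ φ-φ (k % N) (k / N * N) x ⟨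
    φ (k % N) (φ (k / N * N) x)       ≈⟨ φ-cong (k % N) (φ-*N (k / N) x) ⟩
    φ (k % N) x                       ∎)

  φ-neg : ∀ k x → φ (neg N k) (φ k x) ≈ x
  φ-neg k x = ≈trans (φ-φ (neg N k) k x) (≈trans (≈sym (φ-% (neg N k + k) x))
    (≈trans (≈reflexive (cong (λ z → φ z x) (neg-+ N k))) (φ-0 x)))

  φ-injective : ∀ k {x y} → φ k x ≈ φ k y → x ≈ y
  φ-injective k {x} {y} p = ≈trans (≈sym (φ-neg k x)) (≈trans (φ-cong (neg N k) p) (φ-neg k y))

  φ-∑ : ∀ j n f → φ j (∑ n f) ≈ ∑ n (φ j ∘ f)
  φ-∑ j zero    f = φ-zero j
  φ-∑ j (suc n) f = ≈trans (φ-+ j (f 0) _) (+ᶠ-cong ≈refl (φ-∑ j n (f ∘ suc)))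

  _·_ : Bool → Carrier → Carrier
  b · x = if b then x else 0#

  ·-cong : ∀ b {x y} → x ≈ y → b · x ≈ b · y
  ·-cong true  p = p
  ·-cong false p = ≈refl

  ·-+ : ∀ b x y → b · (x +ᶠ y) ≈ b · x +ᶠ b · y
  ·-+ true  x y = ≈refl
  ·-+ false x y = ≈sym (+ᶠ-identityˡ 0#)

  ·-xor : ∀ a b x → a · x +ᶠ b · x ≈ (a xor b) · x
  ·-xor true  true  x = x+x≈0 x
  ·-xor true  false x = +ᶠ-identityʳ x
  ·-xor false b     x = +ᶠ-identityˡ (b · x)

  φ-· : ∀ j b x → φ j (b · x) ≈ b · φ j x
  φ-· j true  x = ≈refl
  φ-· j false x = φ-zero j

  -- A linearized polynomial with coefficients in GF(2). The coefficients are indexed by all natural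
  -- numbers so that a combination can be split into halves, as in `comb-split`.
  comb : ℕ → (ℕ → Bool) → Carrier → Carrier
  comb n a β = ∑ n (λ i → a i · φ i β)

  comb-cong : ∀ n a {β γ} → β ≈ γ → comb n a β ≈ comb n a γ
  comb-cong n a p = ∑-cong n (λ i → ·-cong (a i) (φ-cong i p))

  comb-+ : ∀ n a β γ → comb n a (β +ᶠ γ) ≈ comb n a β +ᶠ comb n a γ
  comb-+ n a β γ = ≈trans (∑-cong n (λ i → ≈trans (·-cong (a i) (φ-+ i β γ)) (·-+ (a i) _ _))) (≈sym (∑-+ n _ _))

  comb-xor : ∀ n a b β → comb n a β +ᶠ comb n b β ≈ comb n (λ i → a i xor b i) β
  comb-xor n a b β = ≈trans (∑-+ n _ _) (∑-cong n (λ i → ·-xor (a i) (b i) _))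

  φ-comb : ∀ j n a β → φ j (comb n a β) ≈ comb n a (φ j β)
  φ-comb j n a β = ≈trans (φ-∑ j n _) (∑-cong n (λ i → ≈trans (φ-· j (a i) _) (·-cong (a i) (φ-comm j i β))))

  comb-split : ∀ m n a β → comb (m + n) a β ≈ comb m a β +ᶠ comb n (a ∘ (m +_)) (φ m β)
  comb-split m n a β = ≈trans (∑-split m n _) (+ᶠ-cong ≈refl (∑-cong n (λ i → ·-cong (a (m + i))
    (≈trans (≈reflexive (cong (λ k → φ k β) (ℕP.+-comm m i))) (≈sym (φ-φ i m β))))))

  trace : ℕ → Carrier → Carrier
  trace n β = ∑ n (λ i → φ i β)

  trace-+ : ∀ n β γ → trace n (β +ᶠ γ) ≈ trace n β +ᶠ trace n γ
  trace-+ n β γ = ≈trans (∑-cong n (λ i → φ-+ i β γ)) (≈sym (∑-+ n _ _))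

  trace-cong : ∀ n {β γ} → β ≈ γ → trace n β ≈ trace n γ
  trace-cong n p = ∑-cong n (λ i → φ-cong i p)

  trace-double : ∀ h β → trace (h + h) β ≈ trace h (β +ᶠ φ h β)
  trace-double h β = ≈trans (∑-split h h _) (≈trans (+ᶠ-cong ≈refl (∑-cong h (λ i →
    ≈trans (≈reflexive (cong (λ k → φ k β) (ℕP.+-comm h i))) (≈sym (φ-φ i h β))))) (≈sym (trace-+ h β (φ h β))))

  -- Let h be half the length and δ = β + φ h β. Adding to a relation its image under φ h gives a relation for δ
  -- of length h, whose coefficients are the sums of the two halves of a; if these vanish, then a repeats its first
  -- half, which is itself a relation for δ. The trace of β is that of δ.
  relation⇒trace≈0 : ∀ e a β → φ (2 ^ e) β ≈ β → (Σ[ j ∈ ℕ ] j < 2 ^ e × a j ≡ true) →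
    comb (2 ^ e) a β ≈ 0# → trace (2 ^ e) β ≈ 0#
  relation⇒trace≈0 zero    a β per (zero , _ , a₀) rel =
    ≈trans (≈reflexive (cong (λ b → b · φ 0 β +ᶠ 0#) (sym a₀))) rel
  relation⇒trace≈0 zero    a β per (suc _ , s≤s () , _) rel
  relation⇒trace≈0 (suc e) a β per (j , j<2h , aⱼ) rel =
    ≈trans (≈reflexive (cong (λ n → trace n β) h+h)) (≈trans (trace-double h β) (fold (∃⊎∀< h (λ i → a i xor b i))))
    where
    h = 2 ^ e
    h+h : 2 * h ≡ h + h
    h+h = cong (h +_) (ℕP.+-identityʳ h)
    b = a ∘ (h +_)
    β′ = φ h β
    δ = β +ᶠ β′
    β″ : φ h β′ ≈ β
    β″ = ≈trans (φ-φ h h β) (≈trans (≈reflexive (cong (λ k → φ k β) (sym h+h))) per)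
    δ-per : φ h δ ≈ δ
    δ-per = ≈trans (φ-+ h β β′) (≈trans (+ᶠ-cong ≈refl β″) (+ᶠ-comm β′ β))
    rel₁ : comb h a β +ᶠ comb h b β′ ≈ 0#
    rel₁ = ≈trans (≈sym (comb-split h h a β)) (≈trans (≈reflexive (cong (λ n → comb n a β) (sym h+h))) rel)
    rel₂ : comb h a β′ +ᶠ comb h b β ≈ 0#
    rel₂ = begin
      comb h a β′ +ᶠ comb h b β             ≈⟨ +ᶠ-cong (φ-comb h h a β) (≈trans (φ-comb h h b β′) (comb-cong h b β″)) ⟨
      φ h (comb h a β) +ᶠ φ h (comb h b β′) ≈⟨ φ-+ h _ _ ⟨
      φ h (comb h a β +ᶠ comb h b β′)       ≈⟨ φ-cong h rel₁ ⟩
      φ h 0#                                ≈⟨ φ-zero h ⟩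
      0#                                    ∎
    fold : (Σ[ j ∈ ℕ ] j < h × a j xor b j ≡ true) ⊎ (∀ j → j < h → a j xor b j ≡ false) → trace h δ ≈ 0#
    fold (inj₁ differ) = relation⇒trace≈0 e (λ i → a i xor b i) δ δ-per differ (begin
      comb h (λ i → a i xor b i) δ                                     ≈⟨ comb-xor h a b δ ⟨
      comb h a δ +ᶠ comb h b δ                                         ≈⟨ +ᶠ-cong (comb-+ h a β β′) (comb-+ h b β β′) ⟩
      comb h a β +ᶠ comb h a β′ +ᶠ (comb h b β +ᶠ comb h b β′)
        ≈⟨ solve 4 (λ x y z w → (x :+ y) :+ (z :+ w) := (x :+ w) :+ (y :+ z)) ≈refl (comb h a β) (comb h a β′) (comb h b β) (comb h b β′) ⟩
      comb h a β +ᶠ comb h b β′ +ᶠ (comb h a β′ +ᶠ comb h b β)         ≈⟨ +ᶠ-cong rel₁ rel₂ ⟩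
      0# +ᶠ 0#                                                         ≈⟨ +ᶠ-identityˡ 0# ⟩
      0#                                                               ∎)
    fold (inj₂ agree) = relation⇒trace≈0 e a δ δ-per nonzero (begin
      comb h a δ                ≈⟨ comb-+ h a β β′ ⟩
      comb h a β +ᶠ comb h a β′ ≈⟨ +ᶠ-cong ≈refl (∑-cong< h (λ i i<h → ≈reflexive (cong (_· φ i β′) (same i i<h)))) ⟩
      comb h a β +ᶠ comb h b β′ ≈⟨ rel₁ ⟩
      0#                        ∎)
      where
      same : ∀ i → i < h → a i ≡ b i
      same i i<h = xor≡false (a i) (b i) (agree i i<h)
      nonzero : Σ[ j ∈ ℕ ] j < h × a j ≡ true
      nonzero with ℕP.<-≤-connex j h
      ... | inj₁ j<h = j , j<h , aⱼ
      ... | inj₂ h≤j = j ∸ h , j∸h<h , trans (same (j ∸ h) j∸h<h) (trans (cong a (ℕP.m+[n∸m]≡n h≤j)) aⱼ)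
        where
        j∸h<h : j ∸ h < h
        j∸h<h = ℕP.+-cancelˡ-< h (j ∸ h) h (ℕP.≤-trans (s≤s (ℕP.≤-reflexive (ℕP.m+[n∸m]≡n h≤j))) (ℕP.≤-trans j<2h (ℕP.≤-reflexive h+h)))

  -- The trace as a criterion for normality.

  tr : Carrier → Carrier
  tr = trace N

  tr-φ : ∀ k β → tr (φ k β) ≈ tr β
  tr-φ k β = ≈trans (∑-cong N (λ i → φ-φ i k β)) (∑-periodic N k (λ i → ≈trans (≈sym (φ-φ N i β)) (φ-N (φ i β))))

  tr-0 : tr 0# ≈ 0#
  tr-0 = go N
    where
    go : ∀ n → trace n 0# ≈ 0#
    go n = ≈trans (trace-cong n (≈sym (x+x≈0 0#))) (≈trans (trace-+ n 0# 0#) (x+x≈0 _))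

  tr-· : ∀ b β → tr (b · β) ≈ b · tr β
  tr-· true  β = ≈refl
  tr-· false β = tr-0

  -- All conjugates of `β` have the same trace, so every true coefficient contributes one copy of
  -- `tr β`, and equal copies cancel in pairs.
  tr-comb : ∀ a β → tr (comb N a β) ≈ parity N a · tr β
  tr-comb a β = ≈trans (tr-∑ N (λ i → a i · φ i β))
    (≈trans (∑-cong N (λ i → ≈trans (tr-· (a i) (φ i β)) (·-cong (a i) (tr-φ i β)))) (∑-parity N a))
    where
    tr-∑ : ∀ n f → tr (∑ n f) ≈ ∑ n (tr ∘ f)
    tr-∑ zero    f = tr-0
    tr-∑ (suc n) f = ≈trans (trace-+ N (f 0) _) (+ᶠ-cong ≈refl (tr-∑ n (f ∘ suc)))
    ∑-parity : ∀ n a → ∑ n (λ i → a i · tr β) ≈ parity n a · tr β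
    ∑-parity zero    a = ≈refl
    ∑-parity (suc n) a = ≈trans (+ᶠ-cong ≈refl (∑-parity n (a ∘ suc))) (·-xor (a 0) _ (tr β))

  -- The last summand, of exponent 2^n, supplies the leading coefficient; all earlier exponents are
  -- smaller.
  trace-polynomial : ∀ n → Polynomial 1# (2 ^ n) (trace (suc n))
  trace-polynomial n = Polynomial-cong (2 ^ n) (λ x → ∑-last n (λ i → φ i x))
    (Polynomial-coeff (2 ^ n) (+ᶠ-identityˡ 1#) (Polynomial-+ (2 ^ n) (lower n) (Polynomial-^ (2 ^ n))))
    where
    lower : ∀ n → Polynomial 0# (2 ^ n) (trace n)
    lower zero    = (λ _ → 0#) , (λ _ → ≈refl) , 0# , λ x → ≈sym (≈trans (+ᶠ-cong (*0 x) ≈refl) (+ᶠ-identityˡ 0#))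
    -- The polynomial of degree 2^n is regarded as one of formal degree 2^n + 1 with leading
    -- coefficient 0 and then raised to 2^n + 2^n.
    lower (suc n) = Polynomial-≤ (ℕP.≤-trans (ℕP.+-monoʳ-≤ (2 ^ n) (ℕP.m^n>0 2 n)) (ℕP.≤-reflexive (trans (ℕP.+-comm (2 ^ n) (2 ^ n)) (cong (2 ^ n +_) (sym (ℕP.+-identityʳ (2 ^ n)))))))
      (subst (λ k → Polynomial 0# k (trace (suc n))) (ℕP.+-comm 1 (2 ^ n)) (Polynomial-suc (2 ^ n) (trace-polynomial n)))

  -- The trace has degree 2^(N-1), less than the number of elements 2^N, so it cannot vanish on the
  -- whole field.
  tr-nonzero : Σ Carrier λ γ → tr γ ≉ 0#
  tr-nonzero = let i , p = FinP.¬∀⟶∃¬ q (λ i → tr (el i) ≈ 0#) (λ i → tr (el i) ≟ᶠ 0#) not-all in el i , p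
    where
    n = pred N
    degree : 2 ^ n < q
    degree = ℕP.^-monoʳ-< 2 (s≤s (s≤s z≤n)) (ℕP.≤-reflexive (ℕP.suc-pred N))
    not-all : ¬ (∀ i → tr (el i) ≈ 0#)
    not-all all = few-roots (2 ^ n) (0≉1 ∘ ≈sym) (trace-polynomial n) (λ i → el (inject≤ i degree))
      (λ e → FinP.inject≤-injective degree degree _ _ (el-injective e))
      (λ i → subst (λ k → trace k (el (inject≤ i degree)) ≈ 0#) (sym (ℕP.suc-pred N)) (all (inject≤ i degree)))

  lincomb-∑ : ∀ n (cs : Fin n → Bool) (c : ℕ → Bool) (v : ℕ → Carrier) → (∀ i → cs i ≡ c (toℕ i)) →
    lincomb F cs (v ∘ toℕ) ≈ ∑ n (λ i → c i · v i)
  lincomb-∑ zero    cs c v p = ≈refl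
  lincomb-∑ (suc n) cs c v p = +ᶠ-cong (≈reflexive (cong (_· v 0) (p zero))) (lincomb-∑ n (cs ∘ suc) (c ∘ suc) (v ∘ suc) (p ∘ suc))

  lincomb-conj : ∀ (w : Word N) γ → lincomb F w (conj F N γ) ≈ comb N (extend w) γ
  lincomb-conj w γ = lincomb-∑ N w (extend w) (λ i → φ i γ) (λ i → cong w (sym (mod-toℕ i)))

  tr≉0⇒independent : ∀ {γ} → tr γ ≉ 0# → ∀ (w : Word N) → comb N (extend w) γ ≈ 0# → ∀ i → w i ≡ false
  tr≉0⇒independent {γ} γ≉0 w p i = BoolP.¬-not λ wᵢ →
    γ≉0 (relation⇒trace≈0 d (extend w) γ (φ-N γ) (toℕ i , FinP.toℕ<n i , trans (cong w (mod-toℕ i)) wᵢ) p)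

  comb-injective : ∀ {γ} → tr γ ≉ 0# → ∀ (w w′ : Word N) → comb N (extend w) γ ≈ comb N (extend w′) γ → w ≗ w′
  comb-injective {γ} γ≉0 w w′ p i = xor≡false (w i) (w′ i) (tr≉0⇒independent γ≉0 (λ i → w i xor w′ i)
    (≈trans (≈sym (comb-xor N (extend w) (extend w′) γ)) (≈trans (+ᶠ-cong p ≈refl) (x+x≈0 _))) i)

  -- The 2^N combinations of the conjugates are distinct, hence exhaust the field.
  tr≉0⇒basis : ∀ {γ} → tr γ ≉ 0# → IsGF2Basis F (conj F N γ)
  tr≉0⇒basis {γ} γ≉0 =
    (λ w p → tr≉0⇒independent γ≉0 w (≈trans (≈sym (lincomb-conj w γ)) p)) ,
    λ x → let i , p = Fin-injective⇒surjective {f = f} f-inj (index x) in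
      w i , ≈trans (lincomb-conj (w i) γ) (≈trans (≈sym (el-index _)) (≈trans (≈reflexive (cong el p)) (el-index x)))
    where
    module W = QuotBij (Word-enumerated N)
    w : Fin q → Word N
    w i = proj₁ (W.to-surj i)
    f : Fin q → Fin q
    f i = index (comb N (extend (w i)) γ)
    f-inj : ∀ {i j} → f i ≡ f j → i ≡ j
    f-inj {i} {j} p = trans (sym (proj₂ (W.to-surj i))) (trans (W.to-cong (comb-injective γ≉0 (w i) (w j)
      (≈trans (≈sym (el-index _)) (≈trans (≈reflexive (cong el p)) (el-index _))))) (proj₂ (W.to-surj j)))

  -- The trace is the combination of the conjugates with all coefficients 1; if it vanished, it
  -- would be a nontrivial relation.
  normal⇒tr≉0 : ∀ ((γ , _) : NormalElt F N) → tr γ ≉ 0#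
  normal⇒tr≉0 (γ , independent , _) p =
    case independent (λ _ → true) (≈trans (lincomb-conj (λ _ → true) γ) p) (0 mod N) of λ ()

  -- Unordered normal bases and odd necklaces.

  SameBasis-equiv : IsEquivalence (SameBasis F {N})
  SameBasis-equiv = record
    { refl  = (λ i → i , ≈refl) , (λ i → i , ≈refl)
    ; sym   = λ (p , q) → q , p
    ; trans = λ (p , q) (p′ , q′) → chain p p′ , chain q′ q
    }
    where
    chain : ∀ {x y z : Fin N → Carrier} → (∀ i → Σ (Fin N) λ j → x i ≈ y j) → (∀ i → Σ (Fin N) λ j → y i ≈ z j) →
      ∀ i → Σ (Fin N) λ j → x i ≈ z j
    chain p q i = let j , e = p i ; k , e′ = q j in k , ≈trans e e′

  φ⇒SameBasis : ∀ (x y : NormalElt F N) k → proj₁ x ≈ φ k (proj₁ y) → SameBasis F x y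
  φ⇒SameBasis (γ , _) (γ′ , _) k p = half k p , half (neg N k) (≈sym (≈trans (φ-cong (neg N k) p) (φ-neg k γ′)))
    where
    half : ∀ {γ γ′} k → γ ≈ φ k γ′ → ∀ i → Σ (Fin N) λ j → conj F N γ i ≈ conj F N γ′ j
    half {γ} {γ′} k p i = (toℕ i + k) mod N , (begin
      φ (toℕ i) γ                      ≈⟨ φ-cong (toℕ i) p ⟩
      φ (toℕ i) (φ k γ′)               ≈⟨ φ-φ (toℕ i) k γ′ ⟩
      φ (toℕ i + k) γ′                 ≈⟨ φ-% (toℕ i + k) γ′ ⟨
      φ ((toℕ i + k) % N) γ′           ≡⟨ cong (λ z → φ z γ′) (sym (toℕ-mod (toℕ i + k) N)) ⟩
      φ (toℕ ((toℕ i + k) mod N)) γ′   ∎)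

  -- The conjugate of index 0 is `γ` itself, and the index of its partner among the conjugates of
  -- `γ′` is the exponent.
  SameBasis⇒φ : ∀ (x y : NormalElt F N) → SameBasis F x y → Σ ℕ λ k → proj₁ x ≈ φ k (proj₁ y)
  SameBasis⇒φ (γ , _) (γ′ , _) (p , _) = let j , e = p (0 mod N) in toℕ j , (begin
    γ                          ≈⟨ φ-0 γ ⟨
    φ 0 γ                      ≡⟨ cong (λ k → φ k γ) (sym (trans (toℕ-mod 0 N) (DM.m<n⇒m%n≡m (ℕP.m^n>0 2 d)))) ⟩
    φ (toℕ (0 mod N)) γ        ≈⟨ e ⟩
    φ (toℕ j) γ′               ∎)

  -- The map `φ k` advances the index of each conjugate by `k`, and so does the rotation for the
  -- coefficients. What remains is the same cyclic sum started at `k`.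
  comb-rotate : ∀ (w : Word N) k γ → φ k (comb N (extend (λ i → w (i ⊕ k))) γ) ≈ comb N (extend w) γ
  comb-rotate w k γ = begin
    φ k (comb N (extend (λ i → w (i ⊕ k))) γ)              ≈⟨ φ-∑ k N _ ⟩
    ∑ N (λ i → φ k (extend (λ i → w (i ⊕ k)) i · φ i γ))   ≈⟨ ∑-cong N (λ i → ≈trans (φ-· k _ _)
      (≈trans (≈reflexive (cong (_· φ k (φ i γ)) (extend-shift w k i))) (·-cong (extend w (i + k)) (≈trans (φ-comm k i γ) (φ-φ i k γ))))) ⟩
    ∑ N (λ i → extend w (i + k) · φ (i + k) γ)             ≈⟨ ∑-periodic N k periodic ⟩
    comb N (extend w) γ                                    ∎
    where
    periodic : ∀ i → extend w (N + i) · φ (N + i) γ ≈ extend w i · φ i γ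
    periodic i = ≈trans (≈reflexive (cong (_· φ (N + i) γ) (trans (cong (extend w) (ℕP.+-comm N i)) (extend-periodic w i))))
      (·-cong (extend w i) (≈trans (≈sym (φ-φ N i γ)) (φ-N _)))

  OddWord≃NormalElt : QuotBij (OddWord N) _∼Odd_ (NormalElt F N) (SameBasis F)
  OddWord≃NormalElt = record
    { to      = to
    ; to-cong = λ {x} {y} (k , p) → φ⇒SameBasis (to x) (to y) k (≈sym (≈trans
        (φ-cong k (comb-word-cong p)) (comb-rotate (proj₁ x) k γ)))
    ; to-inj  = λ {x} {y} s → let k , p = SameBasis⇒φ (to x) (to y) s in
        k , λ i → sym (comb-injective γ≉0 (λ i → proj₁ x (i ⊕ k)) (proj₁ y)
          (φ-injective k (≈trans (comb-rotate (proj₁ x) k γ) p)) i)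
    ; to-surj = surj
    }
    where
    γ = proj₁ tr-nonzero
    γ≉0 = proj₂ tr-nonzero
    comb-word-cong : ∀ {w w′ : Word N} → w ≗ w′ → comb N (extend w) γ ≈ comb N (extend w′) γ
    comb-word-cong p = ∑-cong N (λ i → ≈reflexive (cong (_· φ i γ) (p (i mod N))))
    odd⇒tr : ∀ (w : Word N) → parity N (extend w) ≡ true → tr (comb N (extend w) γ) ≈ tr γ
    odd⇒tr w p = ≈trans (tr-comb (extend w) γ) (≈reflexive (cong (_· tr γ) p))
    to : OddWord N → NormalElt F N
    to (w , odd) = comb N (extend w) γ , tr≉0⇒basis (λ z → γ≉0
      (≈trans (≈sym (odd⇒tr w (trans (sym (odd-ones-extend w)) (%2≡1⇒odd (ones w) odd)))) z))
    surj : ∀ y → Σ (OddWord N) λ x → SameBasis F (to x) y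
    surj y@(δ , _) = x , φ⇒SameBasis (to x) y 0 (≈trans w-δ (≈sym (φ-0 δ)))
      where
      w : Word N
      -- These are the coordinates of `δ` in the normal basis generated by `γ`.
      w = proj₁ (proj₂ (tr≉0⇒basis γ≉0) δ)
      w-δ : comb N (extend w) γ ≈ δ
      w-δ = ≈trans (≈sym (lincomb-conj w γ)) (proj₂ (proj₂ (tr≉0⇒basis γ≉0) δ))
      odd : parity N (extend w) ≡ true
      -- An even number of ones would make the trace of `δ` vanish, although `δ` is normal.
      odd = BoolP.¬-not λ even → normal⇒tr≉0 y (≈trans (trace-cong N (≈sym w-δ))
        (≈trans (tr-comb (extend w) γ) (≈reflexive (cong (_· tr γ) even))))
      x : OddWord N
      x = w , odd⇒%2≡1 (ones w) (trans (odd-ones-extend w) odd)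

-- Comparison of the counts.

DeBruijn-enumerated : ∀ d → Enumerated (DeBruijn (suc d)) _∼DB_ (#trees d)
DeBruijn-enumerated d = QuotBij-trans ≡-equiv (DeBruijn≃Hamiltonian d)
  (QuotBij-trans ≡-equiv (TwinTree≃RootedTree (λ _ → true)) (RootedTree-enumerated d))

2^pred≡#zeroed : ∀ d → 2 ^ pred (2 ^ d) ≡ #zeroed d
2^pred≡#zeroed d = ℕP.*-cancelˡ-≡ _ _ 2 (begin
  2 * 2 ^ pred (2 ^ d)   ≡⟨ cong (2 ^_) (ℕP.suc-pred (2 ^ d) {{ℕP.m^n≢0 2 d}}) ⟩
  2 ^ (2 ^ d)            ≡⟨ #labellings≡ d ⟨
  #labellings d          ≡⟨ #zeroed-2 d ⟨
  #zeroed d * 2          ≡⟨ ℕP.*-comm (#zeroed d) 2 ⟩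
  2 * #zeroed d          ∎)
  where open ≡-Reasoning

-- Both `k` and `#trees d`, multiplied by 2^d, give the number of odd words, and the factor 2^d
-- cancels.
odd-necklaces-enumerated : ∀ d → Enumerated (OddWord (2 ^ d)) _∼Odd_ (#trees d)
odd-necklaces-enumerated d = let k , necklaces , count = OddWord-necklaces-enumerated d in
  subst (Enumerated (OddWord (2 ^ d)) _∼Odd_)
    (ℕP.*-cancelʳ-≡ k (#trees d) (2 ^ d) {{ℕP.m^n≢0 2 d}}
      (trans (sym count) (trans (2^pred≡#zeroed d) (sym (#trees-2^ d)))))
    necklaces

theorem29 : ∀ {c ℓ : Level} (d : ℕ) → d ≥ 1 →
    (F : Field c ℓ) → HasOrder F (2 ^ (2 ^ d)) →
    QuotBij (DeBruijn (suc d)) _∼DB_ (OddWord (2 ^ d)) _∼Odd_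
    × QuotBij (OddWord (2 ^ d)) _∼Odd_ (NormalElt F (2 ^ d)) (SameBasis F)
    × QuotBij (DeBruijn (suc d)) _∼DB_ (NormalElt F (2 ^ d)) (SameBasis F)
theorem29 d _ F order = db≃odd , OddWord≃NormalElt , QuotBij-trans SameBasis-equiv db≃odd OddWord≃NormalElt
  where
  open NormalBases F d order using (OddWord≃NormalElt; SameBasis-equiv)
  db≃odd : QuotBij (DeBruijn (suc d)) _∼DB_ (OddWord (2 ^ d)) _∼Odd_
  db≃odd = Enumerated⇒QuotBij (∼Odd-equiv {{ℕP.m^n≢0 2 d}}) (DeBruijn-enumerated d) (odd-necklaces-enumerated d)
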